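{- Let $s \ge 1$, let $M_0, M_1, \ldots, M_{s-1}$ be linear orders each equal to $\omega$ or $\omega^*$ which alternate (i.e. $M_{i+1} \neq M_i$ for all $i$), and let $m_i, n_i$ ($i < s$) be non-zero natural numbers. Let $A = M_0^{m_0} \cdot M_1^{m_1} \cdots M_{s-1}^{m_{s-1}}$ and $B = M_0^{n_0} \cdot M_1^{n_1} \cdots M_{s-1}^{n_{s-1}}$ with $A \neq B$ (i.e. $m_i \neq n_i$ for some $i$), let $t$ be the smallest $i$ such that $m_i \neq n_i$, and assume $m_t < n_t$. Then: (i) if $t = s-1$, then $l(A,B) = 2(m_0 + m_1 + \cdots + m_t)$; (ii) if $t = s-2$, then $l(A,B) = 2(m_0 + m_1 + \cdots + m_t) + 1$; (iii) if $t < s-2$, then $l(A,B) = 2(m_0 + m_1 + \cdots + m_t) + 2$.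
   Context: All orders are linear orders. $\omega^*$ is the reverse of $\omega$. For linear orders $X, Y$, $X \cdot Y$ denotes the anti-lexicographic product ("$Y$ copies of $X$"): the set of pairs $(x,y)$ with $x \in X$, $y \in Y$, ordered by comparing $y$ first and then $x$. $M^n$ denotes the product of $n$ copies of $M$. For $n \ge 1$, $X \equiv_n Y$ means player II has a winning strategy in the $n$-move Ehrenfeucht–Fraïssé game on $X$ and $Y$ (in each move player I picks an element of either structure and II picks an element of the other; II wins if the map sending the $i$th element chosen in $X$ to the $i$th chosen in $Y$ is an order-isomorphism of the induced substructures). $X \equiv Y$ (elementary equivalence) holds iff $X \equiv_n Y$ for all $n$. For $X \not\equiv Y$, $l(X,Y)$ is the non-zero natural number $n$ such that $X \equiv_n Y$ but $X \not\equiv_{n+1} Y$. -}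

module Defs where

open import Data.Nat using (ℕ; zero; suc; _+_) renaming (_<_ to _<ℕ_)
open import Data.Fin using (Fin; zero; suc)
open import Data.Vec using (Vec; []; _∷_; lookup)
open import Data.Product using (Σ; _×_; _,_)
open import Data.Sum using (_⊎_)
open import Data.Unit using (⊤)
open import Data.Empty using (⊥)
open import Relation.Binary.PropositionalEquality using (_≡_)
open import Relation.Nullary using (¬_)

-- A (strict) order: a carrier with a strict order relation; equality of
-- elements is propositional equality.  Only concrete linear orders built
-- below are ever used.
record Order : Set₁ where
  field
    Carrier : Set
    _≺_     : Carrier → Carrier → Set
open Order public

ωO : Order
ωO = record { Carrier = ℕ ; _≺_ = _<ℕ_ }

ω*O : Order
ω*O = record { Carrier = ℕ ; _≺_ = λ x y → y <ℕ x }

𝟙 : Order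
𝟙 = record { Carrier = ⊤ ; _≺_ = λ _ _ → ⊥ }

_·_ : Order → Order → Order
X · Y = record
  { Carrier = Carrier X × Carrier Y
  ; _≺_ = λ { (x , y) (x' , y') → _≺_ Y y y' ⊎ (y ≡ y' × _≺_ X x x') } }

_^_ : Order → ℕ → Order
X ^ zero  = 𝟙
X ^ suc k = (X ^ k) · X

∏ : (s : ℕ) → (Fin s → Order) → Order
∏ zero    f = 𝟙
∏ (suc s) f = f zero · ∏ s (λ i → f (suc i))

data Dir : Set where
  omega omega* : Dir

⟦_⟧ : Dir → Order
⟦ omega ⟧  = ωO
⟦ omega* ⟧ = ω*O

psum : {s : ℕ} → (Fin s → ℕ) → ℕ → ℕ
psum {zero}  m k       = 0
psum {suc s} m zero    = 0
psum {suc s} m (suc k) = m zero + psum (λ i → m (suc i)) k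

_iff_ : Set → Set → Set
P iff Q = (P → Q) × (Q → P)

PartIso : (X Y : Order) {k : ℕ} → Vec (Carrier X) k → Vec (Carrier Y) k → Set
PartIso X Y a b = ∀ i j →
  ((lookup a i ≡ lookup a j) iff (lookup b i ≡ lookup b j)) ×
  (_≺_ X (lookup a i) (lookup a j) iff _≺_ Y (lookup b i) (lookup b j))

-- II has a winning strategy in the n-move EF game from position (a , b)
Win : (X Y : Order) {k : ℕ} → ℕ → Vec (Carrier X) k → Vec (Carrier Y) k → Set
Win X Y zero    a b = PartIso X Y a b
Win X Y (suc n) a b =
  ((x : Carrier X) → Σ (Carrier Y) λ y → Win X Y n (x ∷ a) (y ∷ b)) ×
  ((y : Carrier Y) → Σ (Carrier X) λ x → Win X Y n (x ∷ a) (y ∷ b))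

_≡[_]_ : Order → ℕ → Order → Set
X ≡[ n ] Y = Win X Y n [] []

lEq : Order → Order → ℕ → Set
lEq X Y n = (1 Data.Nat.≤ n) × (X ≡[ n ] Y) × ¬ (X ≡[ suc n ] Y)

{-# OPTIONS --safe #-}
module Submission where

-- Upper bounds.  An initial segment of X · Y is a multiple of X followed by an initial segment of X, so
-- all segments arising in the games on A and B are again sums and products of 1, ω, ω* and finite orders.
-- Hence the games can be played on terms, replacing a position by the terms for the two segments it
-- leaves.  Let W be a product of p ≥ 1 copies of ω or ω*, with last factor ω.  By induction on p, W · Y
-- and W · Y' agree in 2p moves if Y and Y' have first elements, and in 2p + 1 if moreover each has
-- another element; also in 2p + 1 if Y and Y' are non-empty without first element, and in 2p + 2 if
-- neither has a first or a last element.  Reversing all orders gives the case of last factor ω*.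
-- With p = m₀ + ⋯ + m_t, both A and B have this form for a common W, with Y the product of the factors
-- of A after the t-th, and Y' the product of ω^(n_t − m_t) and the factors of B after the t-th.
--
-- Lower bounds.  Writing points of W · Y as (w, y), 2p quantifiers suffice to mark the points (0, y) with
-- y not first in Y: they are limits of points marked at level p − 1.  The three cases are told apart by the
-- existence of a marked point, of a marked point after which none is marked, and of a limit of marked
-- points, at a cost of 2p + 1, 2p + 2 and 2p + 3 quantifiers.

open import Defs
open import Data.Empty using (⊥; ⊥-elim)
open import Data.Fin using (Fin; zero; suc; toℕ)
open import Data.Nat using (ℕ; zero; suc; _+_; _*_; _∸_; _≤_; _<_; z≤n; s≤s; s≤s⁻¹; NonZero)
open import Data.Nat.Properties
open import Data.Product using (Σ; _×_; _,_; proj₁; proj₂; swap)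
open import Data.Sum using (_⊎_; inj₁; inj₂)
open import Data.Unit using (⊤; tt)
open import Data.Vec using (Vec; []; _∷_; lookup; map)
open import Function using (id; _∘_)
open import Relation.Binary.Definitions using (tri<; tri≈; tri>)
open import Relation.Binary.PropositionalEquality
open import Relation.Nullary using (¬_; Dec; yes; no)
open import Relation.Nullary.Decidable using (_⊎-dec_; _×-dec_)

-- Terms and the game on segments

infixr 5 _⊕_
infixl 6 _⊗_

data Term : Set where
  ε 𝟏     : Term
  ord     : Dir → Term
  _⊕_ _⊗_ : Term → Term → Term

𝟘 : Order
𝟘 = record { Carrier = ⊥ ; _≺_ = λ _ _ → ⊥ }

data SumOrder (X Y : Order) : Carrier X ⊎ Carrier Y → Carrier X ⊎ Carrier Y → Set where
  left  : ∀ {x x'} → _≺_ X x x' → SumOrder X Y (inj₁ x) (inj₁ x')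
  cross : ∀ {x y} → SumOrder X Y (inj₁ x) (inj₂ y)
  right : ∀ {y y'} → _≺_ Y y y' → SumOrder X Y (inj₂ y) (inj₂ y')

dirLess : Dir → ℕ → ℕ → Set
dirLess omega  x y = x < y
dirLess omega* x y = y < x

⟦_⟧ₜ : Term → Order
⟦ ε ⟧ₜ     = 𝟘
⟦ 𝟏 ⟧ₜ     = 𝟙
⟦ ord d ⟧ₜ = record { Carrier = ℕ ; _≺_ = dirLess d }
⟦ a ⊕ b ⟧ₜ = record { Carrier = Carrier ⟦ a ⟧ₜ ⊎ Carrier ⟦ b ⟧ₜ ; _≺_ = SumOrder ⟦ a ⟧ₜ ⟦ b ⟧ₜ }
⟦ a ⊗ b ⟧ₜ = ⟦ a ⟧ₜ · ⟦ b ⟧ₜ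

Point : Term → Set
Point e = Carrier ⟦ e ⟧ₜ

fin fin* : ℕ → Term
fin zero     = ε
fin (suc k)  = fin k ⊕ 𝟏
fin* zero    = ε
fin* (suc k) = 𝟏 ⊕ fin* k

-- Segments of terms are terms again: in a product, the complete copies of `a` on one side of `y`,
-- joined to a segment of the copy containing `x`. Final segments of ω and initial segments of ω* do
-- not depend on the point.
below above : (e : Term) → Point e → Term
below 𝟏            _        = ε
below (ord omega)  k        = fin k
below (ord omega*) _        = ord omega*
below (a ⊕ b)      (inj₁ x) = below a x
below (a ⊕ b)      (inj₂ y) = a ⊕ below b y
below (a ⊗ b)      (x , y)  = a ⊗ below b y ⊕ below a x

above 𝟏            _        = ε
above (ord omega)  _        = ord omega
above (ord omega*) k        = fin* k
above (a ⊕ b)      (inj₁ x) = above a x ⊕ b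
above (a ⊕ b)      (inj₂ y) = above b y
above (a ⊗ b)      (x , y)  = above a x ⊕ a ⊗ above b y

infix 4 _≃[_]_ _≃_

mutual
  -- A chosen pair of points splits the game into two independent ones, so a position is kept as
  -- pairs of segments and not as a list of chosen points.
  data _≃[_]_ : Term → ℕ → Term → Set where
    stop : ∀ {X Y} → X ≃[ 0 ] Y
    move : ∀ {X Y n} → Forth X n Y → Forth Y n X → X ≃[ suc n ] Y

  Forth : Term → ℕ → Term → Set
  Forth X n Y = (x : Point X) → Σ (Point Y) λ y →
    (below X x ≃[ n ] below Y y) × (above X x ≃[ n ] above Y y)

-- Takes the place of isomorphism: the laws of arithmetic hold in this sense by induction on the
-- number of moves, without bijections between carriers.
_≃_ : Term → Term → Set
X ≃ Y = ∀ n → X ≃[ n ] Y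

≃-sym : ∀ {n X Y} → X ≃[ n ] Y → Y ≃[ n ] X
≃-sym stop       = stop
≃-sym (move f g) = move g f

≃-refl : ∀ {n X} → X ≃[ n ] X
≃-refl {zero}  = stop
≃-refl {suc n} = move (λ x → x , ≃-refl , ≃-refl) (λ x → x , ≃-refl , ≃-refl)

≃-reflexive : ∀ {n X Y} → X ≡ Y → X ≃[ n ] Y
≃-reflexive refl = ≃-refl

mutual
  ≃-trans : ∀ {n X Y Z} → X ≃[ n ] Y → Y ≃[ n ] Z → X ≃[ n ] Z
  ≃-trans stop       stop         = stop
  ≃-trans {suc n} {X} {Y} {Z} (move f g) (move f' g') =
    move (forth-trans n X Y Z f f') (forth-trans n Z Y X g' g)

  forth-trans : ∀ n X Y Z → Forth X n Y → Forth Y n Z → Forth X n Z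
  forth-trans n X Y Z f f' x with f x
  ... | y , l , u with f' y
  ... | z , l' , u' = z , ≃-trans l l' , ≃-trans u u'

mutual
  ≃-lower : ∀ {m n X Y} → m ≤ n → X ≃[ n ] Y → X ≃[ m ] Y
  ≃-lower z≤n     _          = stop
  ≃-lower {X = X} {Y} (s≤s p) (move f g) = move (forth-lower X Y p f) (forth-lower Y X p g)

  forth-lower : ∀ {m n} X Y → m ≤ n → Forth X n Y → Forth X m Y
  forth-lower X Y p f x with f x
  ... | y , l , u = y , ≃-lower p l , ≃-lower p u

empties : ∀ {n X Y} → ¬ Point X → ¬ Point Y → X ≃[ n ] Y
empties {zero}  _ _ = stop
empties {suc n} p q = move (⊥-elim ∘ p) (⊥-elim ∘ q)

-- Arithmetic of sums and products up to equivalence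

⊕-cong : ∀ {n X X' Y Y'} → X ≃[ n ] X' → Y ≃[ n ] Y' → X ⊕ Y ≃[ n ] X' ⊕ Y'
⊕-forth : ∀ {n X X' Y Y'} → X ≃[ suc n ] X' → Y ≃[ suc n ] Y' → Forth (X ⊕ Y) n (X' ⊕ Y')
⊕-cong {zero}  _ _ = stop
⊕-cong {suc n} p q = move (⊕-forth p q) (⊕-forth (≃-sym p) (≃-sym q))
⊕-forth {n} (move f _) q (inj₁ x) with f x
... | x' , l , u = inj₁ x' , l , ⊕-cong u (≃-lower (n≤1+n n) q)
⊕-forth {n} p (move f _) (inj₂ y) with f y
... | y' , l , u = inj₂ y' , ⊕-cong (≃-lower (n≤1+n n) p) l , u

⊗-cong : ∀ {n X X' Y Y'} → X ≃[ n ] X' → Y ≃[ n ] Y' → X ⊗ Y ≃[ n ] X' ⊗ Y'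
⊗-forth : ∀ {n X X' Y Y'} → X ≃[ suc n ] X' → Y ≃[ suc n ] Y' → Forth (X ⊗ Y) n (X' ⊗ Y')
⊗-cong {zero}  _ _ = stop
⊗-cong {suc n} p q = move (⊗-forth p q) (⊗-forth (≃-sym p) (≃-sym q))
⊗-forth {n} p@(move f _) (move g _) (x , y) with f x | g y
... | x' , l , u | y' , l' , u' =
  (x' , y') , ⊕-cong (⊗-cong (≃-lower (n≤1+n n) p) l') l
            , ⊕-cong u (⊗-cong (≃-lower (n≤1+n n) p) u')

⊕-assoc : ∀ {X Y Z} → (X ⊕ Y) ⊕ Z ≃ X ⊕ (Y ⊕ Z)
⊕-assoc zero = stop
⊕-assoc (suc n) = move
  (λ { (inj₁ (inj₁ x)) → inj₁ x        , ≃-refl    , ⊕-assoc n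
     ; (inj₁ (inj₂ y)) → inj₂ (inj₁ y) , ≃-refl    , ≃-refl
     ; (inj₂ z)        → inj₂ (inj₂ z) , ⊕-assoc n , ≃-refl })
  (λ { (inj₁ x)        → inj₁ (inj₁ x) , ≃-refl    , ≃-sym (⊕-assoc n)
     ; (inj₂ (inj₁ y)) → inj₁ (inj₂ y) , ≃-refl    , ≃-refl
     ; (inj₂ (inj₂ z)) → inj₂ z        , ≃-sym (⊕-assoc n) , ≃-refl })

⊕-identityˡ : ∀ {X Y} → ¬ Point Y → Y ⊕ X ≃ X
⊕-identityˡ p zero    = stop
⊕-identityˡ p (suc n) = move
  (λ { (inj₁ y) → ⊥-elim (p y)
     ; (inj₂ x) → x , ⊕-identityˡ p n , ≃-refl })
  (λ x → inj₂ x , ≃-sym (⊕-identityˡ p n) , ≃-refl)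

⊕-identityʳ : ∀ {X Y} → ¬ Point Y → X ⊕ Y ≃ X
⊕-identityʳ p zero    = stop
⊕-identityʳ p (suc n) = move
  (λ { (inj₁ x) → x , ≃-refl , ⊕-identityʳ p n
     ; (inj₂ y) → ⊥-elim (p y) })
  (λ x → inj₁ x , ≃-refl , ≃-sym (⊕-identityʳ p n))

⊗-distribˡ-⊕ : ∀ {X Y Z} → X ⊗ (Y ⊕ Z) ≃ X ⊗ Y ⊕ X ⊗ Z
⊗-distribˡ-⊕ zero = stop
⊗-distribˡ-⊕ {X} {Y} {Z} (suc n) = move
  (λ { (x , inj₁ y) → inj₁ (x , y) , ≃-refl , above-case x y
     ; (x , inj₂ z) → inj₂ (x , z) , below-case x z , ≃-refl })
  (λ { (inj₁ (x , y)) → (x , inj₁ y) , ≃-refl , ≃-sym (above-case x y)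
     ; (inj₂ (x , z)) → (x , inj₂ z) , ≃-sym (below-case x z) , ≃-refl })
  where
  above-case : ∀ x y → above X x ⊕ X ⊗ (above Y y ⊕ Z) ≃[ n ] (above X x ⊕ X ⊗ above Y y) ⊕ X ⊗ Z
  above-case x y = ≃-trans (⊕-cong ≃-refl (⊗-distribˡ-⊕ n)) (≃-sym (⊕-assoc n))

  below-case : ∀ x z → X ⊗ (Y ⊕ below Z z) ⊕ below X x ≃[ n ] X ⊗ Y ⊕ (X ⊗ below Z z ⊕ below X x)
  below-case x z = ≃-trans (⊕-cong (⊗-distribˡ-⊕ n) ≃-refl) (⊕-assoc n)

⊗-identityʳ : ∀ {X} → X ⊗ 𝟏 ≃ X
⊗-identityʳ zero    = stop
⊗-identityʳ (suc n) = move
  (λ { (x , tt) → x , ⊕-identityˡ proj₂ n , ⊕-identityʳ proj₂ n })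
  (λ x → (x , tt) , ≃-sym (⊕-identityˡ proj₂ n) , ≃-sym (⊕-identityʳ proj₂ n))

⊗-identityˡ : ∀ {X} → 𝟏 ⊗ X ≃ X
⊗-identityˡ zero    = stop
⊗-identityˡ (suc n) = move
  (λ { (tt , x) → x , lower , upper })
  (λ x → (tt , x) , ≃-sym lower , ≃-sym upper)
  where
  lower : ∀ {Y} → 𝟏 ⊗ Y ⊕ ε ≃[ n ] Y
  lower = ≃-trans (⊕-identityʳ id n) (⊗-identityˡ n)
  upper : ∀ {Y} → ε ⊕ 𝟏 ⊗ Y ≃[ n ] Y
  upper = ≃-trans (⊕-identityˡ id n) (⊗-identityˡ n)

⊗-assoc : ∀ {X Y Z} → (X ⊗ Y) ⊗ Z ≃ X ⊗ (Y ⊗ Z)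
⊗-assoc zero = stop
⊗-assoc {X} {Y} {Z} (suc n) = move
  (λ { ((x , y) , z) → (x , (y , z)) , lower , upper })
  (λ { (x , (y , z)) → ((x , y) , z) , ≃-sym lower , ≃-sym upper })
  where
  lower : ∀ {A B C} → (X ⊗ Y) ⊗ A ⊕ (X ⊗ B ⊕ C) ≃[ n ] X ⊗ (Y ⊗ A ⊕ B) ⊕ C
  lower = ≃-sym (≃-trans (⊕-cong (⊗-distribˡ-⊕ n) ≃-refl)
          (≃-trans (⊕-assoc n) (⊕-cong (≃-sym (⊗-assoc n)) ≃-refl)))
  upper : ∀ {A B C} → (A ⊕ X ⊗ B) ⊕ (X ⊗ Y) ⊗ C ≃[ n ] A ⊕ X ⊗ (B ⊕ Y ⊗ C)
  upper = ≃-trans (⊕-assoc n) (⊕-cong ≃-refl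
          (≃-sym (≃-trans (⊗-distribˡ-⊕ n) (⊕-cong ≃-refl (≃-sym (⊗-assoc n))))))

-- Reversal

opp : Dir → Dir
opp omega  = omega*
opp omega* = omega

opp-involutive : ∀ d → opp (opp d) ≡ d
opp-involutive omega  = refl
opp-involutive omega* = refl

rev : Term → Term
rev ε       = ε
rev 𝟏       = 𝟏
rev (ord d) = ord (opp d)
rev (a ⊕ b) = rev b ⊕ rev a
rev (a ⊗ b) = rev a ⊗ rev b

rev-involutive : ∀ e → rev (rev e) ≡ e
rev-involutive ε       = refl
rev-involutive 𝟏       = refl
rev-involutive (ord d) = cong ord (opp-involutive d)
rev-involutive (a ⊕ b) = cong₂ _⊕_ (rev-involutive a) (rev-involutive b)
rev-involutive (a ⊗ b) = cong₂ _⊗_ (rev-involutive a) (rev-involutive b)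

rev-fin : ∀ k → rev (fin k) ≡ fin* k
rev-fin zero    = refl
rev-fin (suc k) = cong (𝟏 ⊕_) (rev-fin k)

rev-fin* : ∀ k → rev (fin* k) ≡ fin k
rev-fin* k = trans (cong rev (sym (rev-fin k))) (rev-involutive (fin k))

mirror : ∀ e → Point e → Point (rev e)
mirror 𝟏       x        = x
mirror (ord d) x        = x
mirror (a ⊕ b) (inj₁ x) = inj₂ (mirror a x)
mirror (a ⊕ b) (inj₂ y) = inj₁ (mirror b y)
mirror (a ⊗ b) (x , y)  = mirror a x , mirror b y

unmirror : ∀ e → Point (rev e) → Point e
unmirror 𝟏       x        = x
unmirror (ord d) x        = x
unmirror (a ⊕ b) (inj₁ y) = inj₂ (unmirror b y)
unmirror (a ⊕ b) (inj₂ x) = inj₁ (unmirror a x)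
unmirror (a ⊗ b) (x , y)  = unmirror a x , unmirror b y

mirror-unmirror : ∀ e x → mirror e (unmirror e x) ≡ x
mirror-unmirror 𝟏       x        = refl
mirror-unmirror (ord d) x        = refl
mirror-unmirror (a ⊕ b) (inj₁ y) = cong inj₁ (mirror-unmirror b y)
mirror-unmirror (a ⊕ b) (inj₂ x) = cong inj₂ (mirror-unmirror a x)
mirror-unmirror (a ⊗ b) (x , y)  = cong₂ _,_ (mirror-unmirror a x) (mirror-unmirror b y)

below-mirror : ∀ e x → below (rev e) (mirror e x) ≡ rev (above e x)
below-mirror 𝟏            x        = refl
below-mirror (ord omega)  x        = refl
below-mirror (ord omega*) x        = sym (rev-fin* x)
below-mirror (a ⊕ b)      (inj₁ x) = cong (rev b ⊕_) (below-mirror a x)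
below-mirror (a ⊕ b)      (inj₂ y) = below-mirror b y
below-mirror (a ⊗ b)      (x , y)  =
  cong₂ _⊕_ (cong (rev a ⊗_) (below-mirror b y)) (below-mirror a x)

above-mirror : ∀ e x → above (rev e) (mirror e x) ≡ rev (below e x)
above-mirror 𝟏            x        = refl
above-mirror (ord omega)  x        = sym (rev-fin x)
above-mirror (ord omega*) x        = refl
above-mirror (a ⊕ b)      (inj₁ x) = above-mirror a x
above-mirror (a ⊕ b)      (inj₂ y) = cong (_⊕ rev a) (above-mirror b y)
above-mirror (a ⊗ b)      (x , y)  =
  cong₂ _⊕_ (above-mirror a x) (cong (rev a ⊗_) (above-mirror b y))

mutual
  rev-cong : ∀ {n X Y} → X ≃[ n ] Y → rev X ≃[ n ] rev Y
  rev-cong stop       = stop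
  rev-cong {suc n} {X} {Y} (move f g) = move (rev-forth n X Y f) (rev-forth n Y X g)

  rev-forth : ∀ n X Y → Forth X n Y → Forth (rev X) n (rev Y)
  rev-forth n X Y f x with f (unmirror X x) | mirror-unmirror X x
  ... | y , l , u | eq = mirror Y y
    , subst₂ (_≃[ n ]_) (sym (trans (cong (below (rev X)) (sym eq)) (below-mirror X _)))
                        (sym (below-mirror Y y)) (rev-cong u)
    , subst₂ (_≃[ n ]_) (sym (trans (cong (above (rev X)) (sym eq)) (above-mirror X _)))
                        (sym (above-mirror Y y)) (rev-cong l)

rev-cancel : ∀ {n X Y} → rev X ≃[ n ] rev Y → X ≃[ n ] Y
rev-cancel {n} {X} {Y} p = subst₂ (_≃[ n ]_) (rev-involutive X) (rev-involutive Y) (rev-cong p)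

-- Upper bounds

point? : ∀ e → Dec (Point e)
point? ε       = no id
point? 𝟏       = yes tt
point? (ord _) = yes 0
point? (a ⊕ b) = point? a ⊎-dec point? b
point? (a ⊗ b) = point? a ×-dec point? b

-- First elements

First : Term → Set
First ε            = ⊥
First 𝟏            = ⊤
First (ord omega)  = ⊤
First (ord omega*) = ⊥
First (a ⊕ b)      = First a ⊎ (¬ Point a × First b)
First (a ⊗ b)      = First a × First b

first-point : ∀ e → First e → Σ (Point e) λ y → ¬ Point (below e y)
first-point 𝟏           _              = tt , id
first-point (ord omega) _              = 0 , id
first-point (a ⊕ b)     (inj₁ p)       = let x , q = first-point a p in inj₁ x , q
first-point (a ⊕ b)     (inj₂ (p , q)) = let y , r = first-point b q in
  inj₂ y , λ { (inj₁ x) → p x ; (inj₂ z) → r z }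
first-point (a ⊗ b)     (p , q)        =
  let x , r = first-point a p
      y , s = first-point b q
  in (x , y) , λ { (inj₁ (_ , z)) → s z ; (inj₂ w) → r w }

first-fin : ∀ k → Point (fin k) → First (fin k)
first-fin (suc zero)    _ = inj₂ (id , tt)
first-fin (suc (suc k)) _ = inj₁ (first-fin (suc k) (inj₂ tt))

first-below : ∀ e → First e → ∀ x → Point (below e x) → First (below e x)
first-below (ord omega) _ k p = first-fin k p
first-below (a ⊕ b) (inj₁ f)       (inj₁ x) p        = first-below a f x p
first-below (a ⊕ b) (inj₁ f)       (inj₂ y) p        = inj₁ f
first-below (a ⊕ b) (inj₂ (e , f)) (inj₁ x) p        = ⊥-elim (e x)
first-below (a ⊕ b) (inj₂ (e , f)) (inj₂ y) (inj₁ x) = ⊥-elim (e x)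
first-below (a ⊕ b) (inj₂ (e , f)) (inj₂ y) (inj₂ z) = inj₂ (e , first-below b f y z)
first-below (a ⊗ b) (f , g) (x , y) p with point? (below b y) | p
... | yes z | _            = inj₁ (f , first-below b g y z)
... | no ¬z | inj₁ (_ , z) = ⊥-elim (¬z z)
... | no ¬z | inj₂ w       = inj₂ (¬z ∘ proj₂ , first-below a f x w)

-- A positive form of the absence of a first element. The empty order satisfies it, so inhabitation
-- is asked for separately.
NoFirst : Term → Set
NoFirst ε            = ⊤
NoFirst 𝟏            = ⊥
NoFirst (ord omega)  = ⊥
NoFirst (ord omega*) = ⊤
NoFirst (a ⊕ b)      = NoFirst a × (Point a ⊎ NoFirst b)
NoFirst (a ⊗ b)      = NoFirst a ⊎ NoFirst b

noFirst-below : ∀ e → NoFirst e → ∀ x → Point (below e x) × NoFirst (below e x)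
noFirst-below (ord omega*) _ x = 0 , tt
noFirst-below (a ⊕ b) (f , g)      (inj₁ x) = noFirst-below a f x
noFirst-below (a ⊕ b) (f , inj₁ z) (inj₂ y) = inj₁ z , f , inj₁ z
noFirst-below (a ⊕ b) (f , inj₂ g) (inj₂ y) =
  let z , h = noFirst-below b g y in inj₂ z , f , inj₂ h
noFirst-below (a ⊗ b) (inj₁ f) (x , y) =
  let z , h = noFirst-below a f x in inj₂ z , inj₁ f , inj₂ h
noFirst-below (a ⊗ b) (inj₂ g) (x , y) =
  let z , h = noFirst-below b g y in inj₁ (x , z) , inj₂ h , inj₁ (x , z)

noLast-above : ∀ e → NoFirst (rev e) → ∀ x → Point (above e x)
noLast-above e f x =
  unmirror (above e x) (subst Point (below-mirror e x) (proj₁ (noFirst-below (rev e) f (mirror e x))))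

FirstOfMany : Term → Set
FirstOfMany Y = First Y × Σ (Point Y) λ y → Point (below Y y)

-- The head of a word is the outermost (most significant) factor.
word : ∀ {p} → Vec Dir p → Term
word []      = 𝟏
word (d ∷ w) = word w ⊗ ord d

rev-word : ∀ {p} (w : Vec Dir p) → rev (word (map opp w)) ≡ word w
rev-word []      = refl
rev-word (d ∷ w) = cong₂ _⊗_ (rev-word w) (cong ord (opp-involutive d))

twice : ℕ → ℕ
twice zero    = 0
twice (suc n) = suc (suc (twice n))

-- For Q = X ⊗ ω, a final segment B of one copy of Q ends with a whole copy of Q, to be added to those of Q ⊗ Y.
absorb : ∀ {n} Q A B Y Y' →
  Q ⊗ (𝟏 ⊕ Y) ≃[ n ] Q ⊗ (𝟏 ⊕ Y') → B ≃[ n ] A ⊕ Q →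
  B ⊕ Q ⊗ Y ≃[ n ] B ⊕ Q ⊗ Y'
absorb {n} Q A B Y Y' p q =
  ≃-trans (unfold Y) (≃-trans (⊕-cong ≃-refl p) (≃-sym (unfold Y')))
  where
  unfold : ∀ Z → B ⊕ Q ⊗ Z ≃[ n ] A ⊕ Q ⊗ (𝟏 ⊕ Z)
  unfold Z = ≃-trans (⊕-cong q ≃-refl) (≃-trans (⊕-assoc n) (⊕-cong ≃-refl
    (≃-sym (≃-trans (⊗-distribˡ-⊕ n) (⊕-cong (⊗-identityʳ n) ≃-refl)))))

mutual
  -- With the factor ω there are `p + 1` factors, and the bound on `j` is twice their number. Player
  -- II always answers in the first copy. Above the chosen points the same word recurs with fewer
  -- moves; below them the factor ω disappears and a shorter word takes over.
  firsts : ∀ {p} (w : Vec Dir p) j → j ≤ suc (suc (twice p)) → ∀ Y Y' → First Y → First Y' →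
    (word w ⊗ ord omega) ⊗ Y ≃[ j ] (word w ⊗ ord omega) ⊗ Y'
  firsts w zero    _       Y Y' f f' = stop
  firsts w (suc j) (s≤s b) Y Y' f f' = move (firsts-forth w j b Y Y' f f') (firsts-forth w j b Y' Y f' f)

  firsts-forth : ∀ {p} (w : Vec Dir p) j → j ≤ suc (twice p) → ∀ Y Y' → First Y → First Y' →
    Forth ((word w ⊗ ord omega) ⊗ Y) j ((word w ⊗ ord omega) ⊗ Y')
  firsts-forth w j b Y Y' f f' ((q , k) , y) with point? (below Y y) | first-point Y' f'
  ... | no ¬z | y' , ¬z' = ((q , k) , y')
      , ⊕-cong (empties (¬z ∘ proj₂) (¬z' ∘ proj₂)) ≃-refl
      , absorb _ (above (word w) q) _ _ _
          (firsts w j (m≤n⇒m≤1+n b) _ _ (inj₁ tt) (inj₁ tt)) ≃-refl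
  -- Below the answer there are 2 complete copies of `word w`, below the challenge ω · Z + `k` of
  -- them for a non-empty Z with a first element. The number 2 is the least for which both orders
  -- have a first element and another one.
  ... | yes z | y' , ¬z' = ((q , 2) , y')
      , ≃-trans (collect (below Y y) k) (≃-trans
          (≃-lower b (initial-segments w _ _ q
            (inj₁ (tt , first-below Y f y z) , inj₁ (1 , z) , inj₂ (inj₂ tt))
            (inj₂ (¬z' ∘ proj₂ , first-fin 2 (inj₂ tt)) , inj₂ (inj₂ tt) , inj₂ (inj₁ (inj₂ tt)))))
          (≃-sym (collect (below Y' y') 2)))
      , absorb _ (above (word w) q) _ _ _
          (firsts w j (m≤n⇒m≤1+n b) _ _ (inj₁ tt) (inj₁ tt)) ≃-refl
    where
    collect : ∀ Z k → (word w ⊗ ord omega) ⊗ Z ⊕ (word w ⊗ fin k ⊕ below (word w) q)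
      ≃[ j ] (word w ⊗ (ord omega ⊗ Z ⊕ fin k)) ⊕ below (word w) q
    collect Z k = ≃-trans (≃-sym (⊕-assoc j)) (⊕-cong
      (≃-trans (⊕-cong (⊗-assoc j) ≃-refl) (≃-sym (⊗-distribˡ-⊕ j))) ≃-refl)

  -- The outermost letter of `w` now plays the part of ω, so the word is one letter shorter. For the
  -- empty word a single move remains, and it suffices that both orders are inhabited.
  initial-segments : ∀ {p} (w : Vec Dir p) Z Z' (q : Point (word w)) → FirstOfMany Z → FirstOfMany Z' →
    word w ⊗ Z ⊕ below (word w) q ≃[ suc (twice p) ] word w ⊗ Z' ⊕ below (word w) q
  initial-segments [] Z Z' q (_ , z , _) (_ , z' , _) = move
    (λ _ → inj₁ (tt , z') , stop , stop) (λ _ → inj₁ (tt , z) , stop , stop)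
  initial-segments (omega ∷ w) Z Z' q m m' = ⊕-cong (firstsOfMany w Z Z' m m') ≃-refl
  -- An initial segment of a product with last factor ω* begins with a whole copy of that product.
  -- Added to the others it makes a last copy, so `Z ⊕ 𝟏` has a last element and another one, and
  -- the mirror image of `firstsOfMany` applies.
  initial-segments {suc p} (omega* ∷ w) Z Z' (r , i) (f , z , x) (f' , z' , x') =
    ≃-trans (attach Z) (≃-trans
      (⊕-cong (rev-cancel (subst (λ v → v ⊗ ord omega ⊗ (𝟏 ⊕ rev Z) ≃[ _ ] v ⊗ ord omega ⊗ (𝟏 ⊕ rev Z'))
        (trans (sym (rev-involutive _)) (cong rev (rev-word w)))
        (firstsOfMany (map opp w) _ _
          (inj₁ tt , inj₂ (mirror Z z) , inj₁ tt) (inj₁ tt , inj₂ (mirror Z' z') , inj₁ tt)))) ≃-refl)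
      (≃-sym (attach Z')))
    where
    attach : ∀ Y → word (omega* ∷ w) ⊗ Y ⊕ below (word (omega* ∷ w)) (r , i)
      ≃[ suc (twice (suc p)) ] (word (omega* ∷ w) ⊗ (Y ⊕ 𝟏)) ⊕ below (word w) r
    attach Y = ≃-trans (≃-sym (⊕-assoc _)) (⊕-cong
      (≃-sym (≃-trans (⊗-distribˡ-⊕ _) (⊕-cong ≃-refl (⊗-identityʳ _)))) ≃-refl)

  -- One move is gained over `firsts` because a point outside the first copy can be answered outside
  -- the first copy: the orders of copies below are then both empty or both have first elements.
  firstsOfMany : ∀ {p} (w : Vec Dir p) → ∀ Y Y' → FirstOfMany Y → FirstOfMany Y' →
    (word w ⊗ ord omega) ⊗ Y ≃[ suc (suc (suc (twice p))) ] (word w ⊗ ord omega) ⊗ Y'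
  firstsOfMany w Y Y' m m' = move (firstsOfMany-forth w Y Y' m m') (firstsOfMany-forth w Y' Y m' m)

  firstsOfMany-forth : ∀ {p} (w : Vec Dir p) → ∀ Y Y' → FirstOfMany Y → FirstOfMany Y' →
    Forth ((word w ⊗ ord omega) ⊗ Y) (suc (suc (twice p))) ((word w ⊗ ord omega) ⊗ Y')
  firstsOfMany-forth w Y Y' (f , _) (f' , y₁ , z₁) ((r , k) , y) with point? (below Y y) | first-point Y' f'
  ... | no ¬z | y' , ¬z' = ((r , k) , y')
      , ⊕-cong (empties (¬z ∘ proj₂) (¬z' ∘ proj₂)) ≃-refl
      , final-segments w r k (above Y y) (above Y' y')
  ... | yes z | _ = ((r , k) , y₁)
      , ⊕-cong (firsts w _ ≤-refl _ _ (first-below Y f y z) (first-below Y' f' y₁ z₁)) ≃-refl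
      , final-segments w r k (above Y y) (above Y' y₁)

  -- `Y` and `Y'` are arbitrary, since the whole copy at the end of the preceding segment serves as
  -- a first element in front of them.
  final-segments : ∀ {p} (w : Vec Dir p) (r : Point (word w)) (k : ℕ) Y Y' →
    above (word w ⊗ ord omega) (r , k) ⊕ (word w ⊗ ord omega) ⊗ Y
      ≃[ suc (suc (twice p)) ] above (word w ⊗ ord omega) (r , k) ⊕ (word w ⊗ ord omega) ⊗ Y'
  final-segments w r k Y Y' = absorb _ (above (word w) r) _ _ _ (firsts w _ ≤-refl _ _ (inj₁ tt) (inj₁ tt)) ≃-refl

-- Player II repeats the coordinate in the word and takes any copy: the orders of copies below are
-- again non-empty and without first element, and the upper segments are handled by
-- `final-segments`.
noFirsts : ∀ {p} (w : Vec Dir p) j → j ≤ suc (suc (suc (twice p))) → ∀ Y Y' →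
  NoFirst Y → NoFirst Y' → Point Y → Point Y' →
  (word w ⊗ ord omega) ⊗ Y ≃[ j ] (word w ⊗ ord omega) ⊗ Y'
noFirsts-forth : ∀ {p} (w : Vec Dir p) j → j ≤ suc (suc (twice p)) → ∀ Y Y' →
  NoFirst Y → NoFirst Y' → Point Y' →
  Forth ((word w ⊗ ord omega) ⊗ Y) j ((word w ⊗ ord omega) ⊗ Y')
noFirsts w zero    _       Y Y' f f' y y' = stop
noFirsts w (suc j) (s≤s b) Y Y' f f' y y' =
  move (noFirsts-forth w j b Y Y' f f' y') (noFirsts-forth w j b Y' Y f' f y)
noFirsts-forth w j b Y Y' f f' y' ((r , k) , y) =
  let z  , g  = noFirst-below Y f y
      z' , g' = noFirst-below Y' f' y'
  in ((r , k) , y')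
   , ⊕-cong (noFirsts w j (m≤n⇒m≤1+n b) _ _ g g' z z') ≃-refl
   , ≃-lower b (final-segments w r k (above Y y) (above Y' y'))

-- The further move is gained above the chosen points: the absorbed copy is first there, and others
-- follow because there is no last one, so `firstsOfMany` applies.
noEnds : ∀ {p} (w : Vec Dir p) Y Y' →
  NoFirst Y → NoFirst Y' → NoFirst (rev Y) → NoFirst (rev Y') → Point Y → Point Y' →
  (word w ⊗ ord omega) ⊗ Y ≃[ suc (suc (suc (suc (twice p)))) ] (word w ⊗ ord omega) ⊗ Y'
noEnds w Y Y' f f' l l' y y' = move (forth Y Y' f f' l l' y') (forth Y' Y f' f l' l y)
  where
  forth : ∀ Y Y' → NoFirst Y → NoFirst Y' → NoFirst (rev Y) → NoFirst (rev Y') → Point Y' →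
    Forth ((word w ⊗ ord omega) ⊗ Y) _ ((word w ⊗ ord omega) ⊗ Y')
  forth Y Y' f f' l l' y' ((r , k) , y) =
    let z  , g  = noFirst-below Y f y
        z' , g' = noFirst-below Y' f' y'
    in ((r , k) , y')
     , ⊕-cong (noFirsts w _ ≤-refl _ _ g g' z z') ≃-refl
     , absorb _ (above (word w) r) _ _ _
         (firstsOfMany w _ _ (inj₁ tt , inj₂ (noLast-above Y l y) , inj₁ tt)
                             (inj₁ tt , inj₂ (noLast-above Y' l' y') , inj₁ tt)) ≃-refl

toward : Dir → Term → Term
toward omega  Y = Y
toward omega* Y = rev Y

-- Reversal also flips the letters of `w`, hence the assumption for all words of the same length.
dualize : ∀ {p n} (P : Dir) (w : Vec Dir p) Y Y' →
  (∀ (v : Vec Dir p) → (word v ⊗ ord omega) ⊗ toward P Y ≃[ n ] (word v ⊗ ord omega) ⊗ toward P Y') →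
  (word w ⊗ ord P) ⊗ Y ≃[ n ] (word w ⊗ ord P) ⊗ Y'
dualize omega  w Y Y' h = h w
dualize omega* w Y Y' h = rev-cancel (subst (λ v → v ⊗ ord omega ⊗ rev Y ≃[ _ ] v ⊗ ord omega ⊗ rev Y')
  (trans (sym (rev-involutive _)) (cong rev (rev-word w))) (h (map opp w)))

-- From the game on segments to the Ehrenfeucht–Fraïssé game

Less : ∀ e → Point e → Point e → Set
Less e = _≺_ ⟦ e ⟧ₜ

less-irrefl : ∀ e {x} → ¬ Less e x x
less-irrefl (ord omega)  p                = <-irrefl refl p
less-irrefl (ord omega*) p                = <-irrefl refl p
less-irrefl (a ⊕ b)      (left p)         = less-irrefl a p
less-irrefl (a ⊕ b)      (right p)        = less-irrefl b p
less-irrefl (a ⊗ b)      (inj₁ p)         = less-irrefl b p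
less-irrefl (a ⊗ b)      (inj₂ (_ , p))   = less-irrefl a p

less-trans : ∀ e {x y z} → Less e x y → Less e y z → Less e x z
less-trans (ord omega)  p q = <-trans p q
less-trans (ord omega*) p q = <-trans q p
less-trans (a ⊕ b) (left p)  (left q)  = left (less-trans a p q)
less-trans (a ⊕ b) (left p)  cross     = cross
less-trans (a ⊕ b) cross     (right q) = cross
less-trans (a ⊕ b) (right p) (right q) = right (less-trans b p q)
less-trans (a ⊗ b) (inj₁ p)          (inj₁ q)          = inj₁ (less-trans b p q)
less-trans (a ⊗ b) (inj₁ p)          (inj₂ (refl , q)) = inj₁ p
less-trans (a ⊗ b) (inj₂ (refl , p)) (inj₁ q)          = inj₁ q
less-trans (a ⊗ b) (inj₂ (refl , p)) (inj₂ (refl , q)) = inj₂ (refl , less-trans a p q)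

fin-value : ∀ k → Point (fin k) → ℕ
fin-value (suc k) (inj₁ x) = fin-value k x
fin-value (suc k) (inj₂ _) = k

fin-value< : ∀ k x → fin-value k x < k
fin-value< (suc k) (inj₁ x) = m≤n⇒m≤1+n (fin-value< k x)
fin-value< (suc k) (inj₂ _) = ≤-refl

fin-value-mono : ∀ k {x y} → Less (fin k) x y → fin-value k x < fin-value k y
fin-value-mono (suc k) (left p)  = fin-value-mono k p
fin-value-mono (suc k) cross     = fin-value< k _

fin-value-onto : ∀ k m → m < k → Σ (Point (fin k)) λ x → fin-value k x ≡ m
fin-value-onto (suc k) m p with m<1+n⇒m<n∨m≡n p
... | inj₁ q = let x , r = fin-value-onto k m q in inj₁ x , r
... | inj₂ q = inj₂ tt , sym q

fin*-value : ∀ k → Point (fin* k) → ℕ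
fin*-value (suc k) (inj₁ _) = k
fin*-value (suc k) (inj₂ x) = fin*-value k x

fin*-value< : ∀ k x → fin*-value k x < k
fin*-value< (suc k) (inj₁ _) = ≤-refl
fin*-value< (suc k) (inj₂ x) = m≤n⇒m≤1+n (fin*-value< k x)

fin*-value-anti : ∀ k {x y} → Less (fin* k) x y → fin*-value k y < fin*-value k x
fin*-value-anti (suc k) cross     = fin*-value< k _
fin*-value-anti (suc k) (right p) = fin*-value-anti k p

fin*-value-onto : ∀ k m → m < k → Σ (Point (fin* k)) λ x → fin*-value k x ≡ m
fin*-value-onto (suc k) m p with m<1+n⇒m<n∨m≡n p
... | inj₁ q = let x , r = fin*-value-onto k m q in inj₂ x , r
... | inj₂ q = inj₁ tt , sym q

fromBelow : ∀ e x → Point (below e x) → Point e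
fromBelow (ord omega)  k w = fin-value k w
fromBelow (ord omega*) k w = suc (k + w)
fromBelow (a ⊕ b) (inj₁ x) w        = inj₁ (fromBelow a x w)
fromBelow (a ⊕ b) (inj₂ y) (inj₁ v) = inj₁ v
fromBelow (a ⊕ b) (inj₂ y) (inj₂ w) = inj₂ (fromBelow b y w)
fromBelow (a ⊗ b) (x , y) (inj₁ (v , w)) = v , fromBelow b y w
fromBelow (a ⊗ b) (x , y) (inj₂ v)       = fromBelow a x v , y

fromAbove : ∀ e x → Point (above e x) → Point e
fromAbove (ord omega)  k w = suc (k + w)
fromAbove (ord omega*) k w = fin*-value k w
fromAbove (a ⊕ b) (inj₁ x) (inj₁ v) = inj₁ (fromAbove a x v)
fromAbove (a ⊕ b) (inj₁ x) (inj₂ w) = inj₂ w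
fromAbove (a ⊕ b) (inj₂ y) w        = inj₂ (fromAbove b y w)
fromAbove (a ⊗ b) (x , y) (inj₁ v)       = fromAbove a x v , y
fromAbove (a ⊗ b) (x , y) (inj₂ (v , w)) = v , fromAbove b y w

fromBelow-less : ∀ e x w → Less e (fromBelow e x w) x
fromBelow-less (ord omega)  k w = fin-value< k w
fromBelow-less (ord omega*) k w = s≤s (m≤m+n k w)
fromBelow-less (a ⊕ b) (inj₁ x) w        = left (fromBelow-less a x w)
fromBelow-less (a ⊕ b) (inj₂ y) (inj₁ v) = cross
fromBelow-less (a ⊕ b) (inj₂ y) (inj₂ w) = right (fromBelow-less b y w)
fromBelow-less (a ⊗ b) (x , y) (inj₁ (v , w)) = inj₁ (fromBelow-less b y w)
fromBelow-less (a ⊗ b) (x , y) (inj₂ v)       = inj₂ (refl , fromBelow-less a x v)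

fromAbove-greater : ∀ e x w → Less e x (fromAbove e x w)
fromAbove-greater (ord omega)  k w = s≤s (m≤m+n k w)
fromAbove-greater (ord omega*) k w = fin*-value< k w
fromAbove-greater (a ⊕ b) (inj₁ x) (inj₁ v) = left (fromAbove-greater a x v)
fromAbove-greater (a ⊕ b) (inj₁ x) (inj₂ w) = cross
fromAbove-greater (a ⊕ b) (inj₂ y) w        = right (fromAbove-greater b y w)
fromAbove-greater (a ⊗ b) (x , y) (inj₁ v)       = inj₂ (refl , fromAbove-greater a x v)
fromAbove-greater (a ⊗ b) (x , y) (inj₂ (v , w)) = inj₁ (fromAbove-greater b y w)

fromBelow-mono : ∀ e x {v w} → Less (below e x) v w → Less e (fromBelow e x v) (fromBelow e x w)
fromBelow-mono (ord omega)  k p = fin-value-mono k p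
fromBelow-mono (ord omega*) k p = s≤s (+-monoʳ-< k p)
fromBelow-mono (a ⊕ b) (inj₁ x) p         = left (fromBelow-mono a x p)
fromBelow-mono (a ⊕ b) (inj₂ y) (left p)  = left p
fromBelow-mono (a ⊕ b) (inj₂ y) cross     = cross
fromBelow-mono (a ⊕ b) (inj₂ y) (right p) = right (fromBelow-mono b y p)
fromBelow-mono (a ⊗ b) (x , y) (left (inj₁ p))          = inj₁ (fromBelow-mono b y p)
fromBelow-mono (a ⊗ b) (x , y) (left (inj₂ (refl , p))) = inj₂ (refl , p)
fromBelow-mono (a ⊗ b) (x , y) cross                    = inj₁ (fromBelow-less b y _)
fromBelow-mono (a ⊗ b) (x , y) (right p)                = inj₂ (refl , fromBelow-mono a x p)

fromAbove-mono : ∀ e x {v w} → Less (above e x) v w → Less e (fromAbove e x v) (fromAbove e x w)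
fromAbove-mono (ord omega)  k p = s≤s (+-monoʳ-< k p)
fromAbove-mono (ord omega*) k p = fin*-value-anti k p
fromAbove-mono (a ⊕ b) (inj₁ x) (left p)  = left (fromAbove-mono a x p)
fromAbove-mono (a ⊕ b) (inj₁ x) cross     = cross
fromAbove-mono (a ⊕ b) (inj₁ x) (right p) = right p
fromAbove-mono (a ⊕ b) (inj₂ y) p         = right (fromAbove-mono b y p)
fromAbove-mono (a ⊗ b) (x , y) (left p)                  = inj₂ (refl , fromAbove-mono a x p)
fromAbove-mono (a ⊗ b) (x , y) cross                     = inj₁ (fromAbove-greater b y _)
fromAbove-mono (a ⊗ b) (x , y) (right (inj₁ p))          = inj₁ (fromAbove-mono b y p)
fromAbove-mono (a ⊗ b) (x , y) (right (inj₂ (refl , p))) = inj₂ (refl , p)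

data Side (e : Term) (x : Point e) : Point e → Set where
  under : ∀ w → Side e x (fromBelow e x w)
  same  : Side e x x
  over  : ∀ w → Side e x (fromAbove e x w)

under≡ : ∀ {e x z} w → fromBelow e x w ≡ z → Side e x z
under≡ w refl = under w

over≡ : ∀ {e x z} w → fromAbove e x w ≡ z → Side e x z
over≡ w refl = over w

side : ∀ e x z → Side e x z
side 𝟏 _ _ = same
side (ord omega) k m with <-cmp k m
... | tri< p _ _    = over≡ (m ∸ suc k) (m+[n∸m]≡n p)
... | tri≈ _ refl _ = same
... | tri> _ _ p    = let w , q = fin-value-onto k m p in under≡ w q
side (ord omega*) k m with <-cmp k m
... | tri< p _ _    = under≡ (m ∸ suc k) (m+[n∸m]≡n p)
... | tri≈ _ refl _ = same
... | tri> _ _ p    = let w , q = fin*-value-onto k m p in over≡ w q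
side (a ⊕ b) (inj₁ x) (inj₁ z) with side a x z
... | under w = under w
... | same    = same
... | over w  = over (inj₁ w)
side (a ⊕ b) (inj₁ x) (inj₂ z) = over (inj₂ z)
side (a ⊕ b) (inj₂ y) (inj₁ z) = under (inj₁ z)
side (a ⊕ b) (inj₂ y) (inj₂ z) with side b y z
... | under w = under (inj₂ w)
... | same    = same
... | over w  = over w
side (a ⊗ b) (x , y) (u , z) with side b y z
... | under w = under (inj₁ (u , w))
... | over w  = over (inj₂ (u , w))
... | same with side a x u
...   | under w = under (inj₂ w)
...   | same    = same
...   | over w  = over (inj₁ w)

-- The points chosen so far, arranged as a search tree; its leaves are the gaps between them.
data Tree (n : ℕ) : Term → Term → Set where
  leaf : ∀ {X Y} → X ≃[ n ] Y → Tree n X Y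
  node : ∀ {X Y} x y → Tree n (below X x) (below Y y) → Tree n (above X x) (above Y y) → Tree n X Y

data Member {n} : ∀ {X Y} → Tree n X Y → Point X → Point Y → Set where
  here  : ∀ {X Y x y} {l : Tree n (below X x) (below Y y)} {r : Tree n (above X x) (above Y y)} →
          Member (node {X = X} {Y} x y l r) x y
  lower : ∀ {X Y x y} {l : Tree n (below X x) (below Y y)} {r : Tree n (above X x) (above Y y)} {u v} →
          Member l u v → Member (node {X = X} {Y} x y l r) (fromBelow X x u) (fromBelow Y y v)
  upper : ∀ {X Y x y} {l : Tree n (below X x) (below Y y)} {r : Tree n (above X x) (above Y y)} {u v} →
          Member r u v → Member (node {X = X} {Y} x y l r) (fromAbove X x u) (fromAbove Y y v)

weaken : ∀ {n X Y} → Tree (suc n) X Y → Tree n X Y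
weaken (leaf p)       = leaf (≃-lower (n≤1+n _) p)
weaken (node x y l r) = node x y (weaken l) (weaken r)

weaken-member : ∀ {n X Y u v} {T : Tree (suc n) X Y} → Member T u v → Member (weaken T) u v
weaken-member here      = here
weaken-member (lower m) = lower (weaken-member m)
weaken-member (upper m) = upper (weaken-member m)

flip-tree : ∀ {n X Y} → Tree n X Y → Tree n Y X
flip-tree (leaf p)       = leaf (≃-sym p)
flip-tree (node x y l r) = node y x (flip-tree l) (flip-tree r)

flip-member : ∀ {n X Y u v} {T : Tree n X Y} → Member T u v → Member (flip-tree T) v u
flip-member here      = here
flip-member (lower m) = lower (flip-member m)
flip-member (upper m) = upper (flip-member m)

record Reply {n X Y} (T : Tree (suc n) X Y) (x : Point X) : Set where
  constructor reply
  field
    answer : Point Y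
    tree   : Tree n X Y
    fresh  : Member tree x answer
    old    : ∀ {u v} → Member T u v → Member tree u v

-- The strategy of the gap containing `x` gives the answer; all other gaps let one move lapse.
insert : ∀ {n X Y} (T : Tree (suc n) X Y) x → Reply T x
insert (leaf (move f _)) x with f x
... | y , p , q = reply y (node x y (leaf p) (leaf q)) here λ ()
insert {X = X} (node z z' l r) x with side X z x
... | same    = reply z' (weaken (node z z' l r)) here weaken-member
... | under w with insert l w
...   | reply y l' m old = reply _ (node z z' l' (weaken r)) (lower m)
        λ { here → here ; (lower k) → lower (old k) ; (upper k) → upper (weaken-member k) }
insert {X = X} (node z z' l r) x | over w with insert r w
...   | reply y r' m old = reply _ (node z z' (weaken l) r') (upper m)
        λ { here → here ; (lower k) → lower (weaken-member k) ; (upper k) → upper (old k) }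

data Alike (X Y : Term) (u u' : Point X) (v v' : Point Y) : Set where
  lt : Less X u u' → Less Y v v' → Alike X Y u u' v v'
  eq : u ≡ u' → v ≡ v' → Alike X Y u u' v v'
  gt : Less X u' u → Less Y v' v → Alike X Y u u' v v'

-- The order of two members is decided at the node where their paths part, in the same way on both
-- sides.
alike : ∀ {n X Y u u' v v'} {T : Tree n X Y} → Member T u v → Member T u' v' → Alike X Y u u' v v'
alike here      here      = eq refl refl
alike {X = X} {Y} here      (lower k) = gt (fromBelow-less X _ _) (fromBelow-less Y _ _)
alike {X = X} {Y} here      (upper k) = lt (fromAbove-greater X _ _) (fromAbove-greater Y _ _)
alike {X = X} {Y} (lower m) here      = lt (fromBelow-less X _ _) (fromBelow-less Y _ _)
alike {X = X} {Y} (upper m) here      = gt (fromAbove-greater X _ _) (fromAbove-greater Y _ _)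
alike {X = X} {Y} (lower m) (upper k) =
  lt (less-trans X (fromBelow-less X _ _) (fromAbove-greater X _ _))
     (less-trans Y (fromBelow-less Y _ _) (fromAbove-greater Y _ _))
alike {X = X} {Y} (upper m) (lower k) =
  gt (less-trans X (fromBelow-less X _ _) (fromAbove-greater X _ _))
     (less-trans Y (fromBelow-less Y _ _) (fromAbove-greater Y _ _))
alike {X = X} {Y} (lower m) (lower k) with alike m k
... | lt p q       = lt (fromBelow-mono X _ p) (fromBelow-mono Y _ q)
... | eq refl refl = eq refl refl
... | gt p q       = gt (fromBelow-mono X _ p) (fromBelow-mono Y _ q)
alike {X = X} {Y} (upper m) (upper k) with alike m k
... | lt p q       = lt (fromAbove-mono X _ p) (fromAbove-mono Y _ q)
... | eq refl refl = eq refl refl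
... | gt p q       = gt (fromAbove-mono X _ p) (fromAbove-mono Y _ q)

alike-iff : ∀ {X Y u u' v v'} → Alike X Y u u' v v' →
  ((u ≡ u') iff (v ≡ v')) × (Less X u u' iff Less Y v v')
alike-iff {X} {Y} (lt p q) =
  ((λ { refl → ⊥-elim (less-irrefl X p) }) , (λ { refl → ⊥-elim (less-irrefl Y q) })) , (λ _ → q) , (λ _ → p)
alike-iff {X} {Y} (eq refl refl) =
  ((λ _ → refl) , (λ _ → refl)) , (⊥-elim ∘ less-irrefl X) , (⊥-elim ∘ less-irrefl Y)
alike-iff {X} {Y} (gt p q) =
  ((λ { refl → ⊥-elim (less-irrefl X p) }) , (λ { refl → ⊥-elim (less-irrefl Y q) })) ,
  (λ r → ⊥-elim (less-irrefl X (less-trans X p r))) , (λ r → ⊥-elim (less-irrefl Y (less-trans Y q r)))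

tree-win : ∀ n {X Y k} (T : Tree n X Y) (a : Vec (Point X) k) (b : Vec (Point Y) k) →
  (∀ i → Member T (lookup a i) (lookup b i)) → Win ⟦ X ⟧ₜ ⟦ Y ⟧ₜ n a b
tree-win zero    T a b m i j = alike-iff (alike (m i) (m j))
tree-win (suc n) {X} {Y} {k} T a b m = forth , back
  where
  forth : ∀ x → Σ (Point Y) λ y → Win ⟦ X ⟧ₜ ⟦ Y ⟧ₜ n (x ∷ a) (y ∷ b)
  forth x with insert T x
  ... | reply y T' new old = y , tree-win n T' (x ∷ a) (y ∷ b)
        λ { zero → new ; (suc i) → old (m i) }
  back : ∀ y → Σ (Point X) λ x → Win ⟦ X ⟧ₜ ⟦ Y ⟧ₜ n (x ∷ a) (y ∷ b)
  back y with insert (flip-tree T) y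
  ... | reply x T' new old = x , tree-win n (flip-tree T') (x ∷ a) (y ∷ b)
        λ { zero → flip-member new ; (suc i) → flip-member (old (flip-member (m i))) }

≃⇒≡ : ∀ {n X Y} → X ≃[ n ] Y → ⟦ X ⟧ₜ ≡[ n ] ⟦ Y ⟧ₜ
≃⇒≡ {n} p = tree-win n (leaf p) [] [] λ ()

-- Lower bounds

win-sym : ∀ n {X Y k} {a : Vec (Carrier X) k} {b : Vec (Carrier Y) k} → Win X Y n a b → Win Y X n b a
win-sym zero    p i j = let q , r = p i j in swap q , swap r
win-sym (suc n) (f , g) = (λ y → let x , p = g y in x , win-sym n p)
                        , (λ x → let y , p = f x in y , win-sym n p)

win-trans : ∀ n {X Y Z k} {a : Vec (Carrier X) k} {b : Vec (Carrier Y) k} {c : Vec (Carrier Z) k} →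
  Win X Y n a b → Win Y Z n b c → Win X Z n a c
win-trans zero p q i j =
  let (e₁ , e₂) , (l₁ , l₂) = p i j
      (e₃ , e₄) , (l₃ , l₄) = q i j
  in (e₃ ∘ e₁ , e₂ ∘ e₄) , (l₃ ∘ l₁ , l₂ ∘ l₄)
win-trans (suc n) (f , g) (f' , g') =
    (λ x → let y , p = f x ; z , q = f' y in z , win-trans n p q)
  , (λ z → let y , q = g' z ; x , p = g y in x , win-trans n p q)

-- The remaining moves are used up by repeating a point already chosen; the argument in `Fin k`
-- provides one.
win-partIso : ∀ n {X Y k} {a : Vec (Carrier X) k} {b : Vec (Carrier Y) k} →
  Fin k → Win X Y n a b → PartIso X Y a b
win-partIso zero    _ p = p
win-partIso (suc n) {a = a} i (f , _) j k =
  win-partIso n zero (proj₂ (f (lookup a i))) (suc j) (suc k)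

Prior : Dir → (X : Order) → Carrier X → Carrier X → Set
Prior omega  X x y = _≺_ X x y
Prior omega* X x y = _≺_ X y x

win-prior : ∀ P n X Y {k} (a : Vec (Carrier X) k) (b : Vec (Carrier Y) k) → Win X Y n a b →
  ∀ i j → Prior P X (lookup a i) (lookup a j) → Prior P Y (lookup b i) (lookup b j)
win-prior omega  n X Y a b win i j = proj₁ (proj₂ (win-partIso n i win i j))
win-prior omega* n X Y a b win i j = proj₁ (proj₂ (win-partIso n i win j i))

-- A point is a limit from the side of P: from below for ω, from above for ω*.
Marked : ∀ {p} → Vec Dir p → (X : Order) → Carrier X → Set
Marked []      X z = ⊤
Marked (P ∷ w) X z =
    Marked w X z
  × (Σ (Carrier X) λ v → Prior P X v z × Marked w X v)
  × (∀ u → Prior P X u z → Marked w X u →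
       Σ (Carrier X) λ v → Prior P X u v × Prior P X v z × Marked w X v)

-- Each level of marking has quantifier depth two, for `u` and then `v`. The hypothesis that `u` is
-- marked occurs negatively and is carried in the opposite direction by `win-sym`.
marked-transfer : ∀ {p} (w : Vec Dir p) n X Y {k} (a : Vec (Carrier X) k) (b : Vec (Carrier Y) k) →
  twice p ≤ n → Win X Y n a b → ∀ i → Marked w X (lookup a i) → Marked w Y (lookup b i)
marked-transfer []      n X Y a b _ win i _ = tt
marked-transfer (P ∷ w) (suc (suc n)) X Y a b (s≤s (s≤s p)) win@(f , g) i
  (mz , (v , v<z , mv) , between) =
    marked-transfer w (suc (suc n)) X Y a b (≤-trans p (m≤n+m n 2)) win i mz
  , (let v' , win₁ = f v in
     v' , win-prior P (suc n) X Y (v ∷ a) (v' ∷ b) win₁ zero (suc i) v<z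
        , marked-transfer w (suc n) X Y (v ∷ a) (v' ∷ b) (m≤n⇒m≤1+n p) win₁ zero mv)
  , λ u' u'<z mu' →
     let u , win₁ = g u'
         win₁'    = win-sym (suc n) {X} {Y} win₁
         u<z      = win-prior P (suc n) Y X (u' ∷ b) (u ∷ a) win₁' zero (suc i) u'<z
         mu       = marked-transfer w (suc n) Y X (u' ∷ b) (u ∷ a) (m≤n⇒m≤1+n p) win₁' zero mu'
         x , u<x , x<z , mx = between u u<z mu
         x' , win₂ = proj₁ win₁ x
         transfer-prior = win-prior P n X Y (x ∷ u ∷ a) (x' ∷ u' ∷ b) win₂
     in x' , transfer-prior (suc zero) zero u<x
           , transfer-prior zero (suc (suc i)) x<z
           , marked-transfer w n X Y (x ∷ u ∷ a) (x' ∷ u' ∷ b) p win₂ zero mx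

prior : Dir → (e : Term) → Point e → Point e → Set
prior P e = Prior P ⟦ e ⟧ₜ

prior-irrefl : ∀ P e {x} → ¬ prior P e x x
prior-irrefl omega  e = less-irrefl e
prior-irrefl omega* e = less-irrefl e

prior-trans : ∀ P e {x y z} → prior P e x y → prior P e y z → prior P e x z
prior-trans omega  e p q = less-trans e p q
prior-trans omega* e p q = less-trans e q p

prior-⊗⁺ : ∀ P a b {x x' y y'} → prior P b y y' ⊎ (y ≡ y' × prior P a x x') →
  prior P (a ⊗ b) (x , y) (x' , y')
prior-⊗⁺ omega  a b p                 = p
prior-⊗⁺ omega* a b (inj₁ p)          = inj₁ p
prior-⊗⁺ omega* a b (inj₂ (refl , p)) = inj₂ (refl , p)

prior-⊗⁻ : ∀ P a b {x x' y y'} → prior P (a ⊗ b) (x , y) (x' , y') →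
  prior P b y y' ⊎ (y ≡ y' × prior P a x x')
prior-⊗⁻ omega  a b p                 = p
prior-⊗⁻ omega* a b (inj₁ p)          = inj₁ p
prior-⊗⁻ omega* a b (inj₂ (refl , p)) = inj₂ (refl , p)

prior-ord⁺ : ∀ P {k l} → k < l → prior P (ord P) k l
prior-ord⁺ omega  p = p
prior-ord⁺ omega* p = p

prior-ord⁻ : ∀ P {k l} → prior P (ord P) k l → k < l
prior-ord⁻ omega  p = p
prior-ord⁻ omega* p = p

prior-opp⁺ : ∀ P {k l} → k < l → prior P (ord (opp P)) l k
prior-opp⁺ omega  p = p
prior-opp⁺ omega* p = p

prior-opp⁻ : ∀ P {k l} → prior P (ord (opp P)) l k → k < l
prior-opp⁻ omega  p = p
prior-opp⁻ omega* p = p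

-- Marked points in iterated products

infixr 6 _⊙_

-- Same order as `word w ⊗ Y`, bracketed so that the outermost factor joins `Y`. This follows the
-- recursion of `Marked`: one level of marking less is the same situation over `ord P ⊗ Y`.
_⊙_ : ∀ {p} → Vec Dir p → Term → Term
[]      ⊙ Y = Y
(P ∷ w) ⊙ Y = w ⊙ (ord P ⊗ Y)

word-⊙ : ∀ {p} (w : Vec Dir p) Y → word w ⊗ Y ≃ w ⊙ Y
word-⊙ []      Y n = ⊗-identityˡ n
word-⊙ (P ∷ w) Y n = ≃-trans (⊗-assoc n) (word-⊙ w (ord P ⊗ Y) n)

origin : ∀ {p} (w : Vec Dir p) Y → Point Y → Point (w ⊙ Y)
origin []      Y y = y
origin (P ∷ w) Y y = origin w (ord P ⊗ Y) (0 , y)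

copy : ∀ {p} (w : Vec Dir p) Y → Point (w ⊙ Y) → Point Y
copy []      Y z = z
copy (P ∷ w) Y z = proj₂ (copy w (ord P ⊗ Y) z)

copy-origin : ∀ {p} (w : Vec Dir p) Y y → copy w Y (origin w Y y) ≡ y
copy-origin []      Y y = refl
copy-origin (P ∷ w) Y y = cong proj₂ (copy-origin w (ord P ⊗ Y) (0 , y))

copy-reflects : ∀ {p} (w : Vec Dir p) Y P {u v} → prior P Y (copy w Y u) (copy w Y v) → prior P (w ⊙ Y) u v
copy-reflects []      Y P p = p
copy-reflects (Q ∷ w) Y P p = copy-reflects w (ord Q ⊗ Y) P (prior-⊗⁺ P (ord Q) Y (inj₁ p))

prior-origin : ∀ {p} (w : Vec Dir p) Y P {u y} →
  prior P Y (copy w Y u) y → prior P (w ⊙ Y) u (origin w Y y)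
prior-origin w Y P p =
  copy-reflects w Y P (subst (prior P Y _) (sym (copy-origin w Y _)) p)

origin-mono : ∀ {p} (w : Vec Dir p) Y P {x y} →
  prior P Y x y → prior P (w ⊙ Y) (origin w Y x) (origin w Y y)
origin-mono w Y P p = prior-origin w Y P (subst (λ x → prior P Y x _) (sym (copy-origin w Y _)) p)

origin-reflects : ∀ {p} (w : Vec Dir p) Y P {x y} →
  prior P (w ⊙ Y) (origin w Y x) (origin w Y y) → prior P Y x y
origin-reflects []      Y P p = p
origin-reflects (Q ∷ w) Y P p with prior-⊗⁻ P (ord Q) Y (origin-reflects w (ord Q ⊗ Y) P p)
... | inj₁ q       = q
... | inj₂ (_ , q) = ⊥-elim (prior-irrefl P (ord Q) q)

HasPrior : ∀ {p} → Vec Dir p → (Y : Term) → Point Y → Set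
HasPrior []      Y y = ⊤
HasPrior (P ∷ _) Y y = Σ (Point Y) λ x → prior P Y x y

-- Against the direction P, every point of ord P ⊗ Y has a neighbour anyway.
hasPrior-⊗ : ∀ {p} (w : Vec Dir p) P Y {k y} →
  Σ (Point (ord P ⊗ Y)) (λ x → prior P (ord P ⊗ Y) x (k , y)) → HasPrior w (ord P ⊗ Y) (k , y)
hasPrior-⊗ []           P      Y h = tt
hasPrior-⊗ (omega ∷ _)  omega  Y h = h
hasPrior-⊗ (omega* ∷ _) omega* Y h = h
hasPrior-⊗ (omega ∷ _)  omega* Y {k} {y} h = (suc k , y) , inj₂ (refl , ≤-refl)
hasPrior-⊗ (omega* ∷ _) omega  Y {k} {y} h = (suc k , y) , inj₂ (refl , ≤-refl)

no-gap : ∀ P Y {k y v} → prior P (ord P ⊗ Y) (k , y) v → prior P (ord P ⊗ Y) v (suc k , y) → ⊥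
no-gap P Y p q with prior-⊗⁻ P (ord P) Y p | prior-⊗⁻ P (ord P) Y q
... | inj₁ r          | inj₁ s          = prior-irrefl P Y (prior-trans P Y r s)
... | inj₁ r          | inj₂ (refl , s) = prior-irrefl P Y r
... | inj₂ (refl , r) | inj₁ s          = prior-irrefl P Y s
... | inj₂ (refl , r) | inj₂ (_ , s)    =
  <-irrefl refl (<-≤-trans (prior-ord⁻ P r) (s≤s⁻¹ (prior-ord⁻ P s)))

-- Together with `origin-marked` this determines the marked points, by induction on the word: at the
-- previous level they are ordered like `ord P ⊗ Y`, up to a first point, and the limits there are
-- the pairs (0, y) with `y` not first.
marked⇒origin : ∀ {p} (w : Vec Dir p) Y z → Marked w ⟦ w ⊙ Y ⟧ₜ z →
  Σ (Point Y) λ y → z ≡ origin w Y y × HasPrior w Y y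
origin-marked : ∀ {p} (w : Vec Dir p) Y y → HasPrior w Y y → Marked w ⟦ w ⊙ Y ⟧ₜ (origin w Y y)
origin-marked []      Y y _       = tt
origin-marked (P ∷ w) Y y (x , p) =
    origin-marked w Z (0 , y) (hasPrior-⊗ w P Y ((0 , x) , p⁺))
  -- The point (0, x) could be the very first of `Z` and hence unmarked; (1, x) has it as a prior
  -- point.
  , (origin w Z (1 , x) , origin-mono w Z P p⁺ , origin-marked w Z (1 , x) (hasNext 0 x))
  , between
  where
  Z = ord P ⊗ Y

  p⁺ : ∀ {k l} → prior P Z (k , x) (l , y)
  p⁺ = prior-⊗⁺ P (ord P) Y (inj₁ p)

  next : ∀ k v → prior P Z (k , v) (suc k , v)
  next k v = prior-⊗⁺ P (ord P) Y (inj₂ (refl , prior-ord⁺ P ≤-refl))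

  hasNext : ∀ k v → HasPrior w Z (suc k , v)
  hasNext k v = hasPrior-⊗ w P Y ((k , v) , next k v)

  between : ∀ u → prior P (w ⊙ Z) u (origin w Z (0 , y)) → Marked w ⟦ w ⊙ Z ⟧ₜ u →
    Σ (Point (w ⊙ Z)) λ v → prior P (w ⊙ Z) u v × prior P (w ⊙ Z) v (origin w Z (0 , y)) × Marked w ⟦ w ⊙ Z ⟧ₜ v
  between u u<y mu with marked⇒origin w Z u mu
  ... | (k , v) , refl , _ with prior-⊗⁻ P (ord P) Y (origin-reflects w Z P u<y)
  ...   | inj₁ q       = origin w Z (suc k , v) , origin-mono w Z P (next k v)
                       , origin-mono w Z P (prior-⊗⁺ P (ord P) Y (inj₁ q))
                       , origin-marked w Z (suc k , v) (hasNext k v)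
  ...   | inj₂ (_ , q) = ⊥-elim (n≮0 (prior-ord⁻ P q))

marked⇒origin []      Y z _ = z , refl , tt
marked⇒origin (P ∷ w) Y z (mz , (v , v<z , mv) , between)
  with marked⇒origin w (ord P ⊗ Y) z mz | marked⇒origin w (ord P ⊗ Y) v mv
... | (k , y) , refl , _ | (l , x) , refl , hv = first-in-copy k between (origin-reflects w Z P v<z)
  where
  Z = ord P ⊗ Y

  -- If (k, y) is marked at the previous level, then nothing lies between it and (k + 1, y), which
  -- is therefore no limit. Below, the marked point (l, x) serves to show that (k, y) has a prior
  -- point.
  successor-isolated : ∀ k → HasPrior w Z (k , y) →
    (∀ u → prior P (w ⊙ Z) u (origin w Z (suc k , y)) → Marked w ⟦ w ⊙ Z ⟧ₜ u →
      Σ (Point (w ⊙ Z)) λ v → prior P (w ⊙ Z) u v × prior P (w ⊙ Z) v (origin w Z (suc k , y)) × Marked w ⟦ w ⊙ Z ⟧ₜ v) → ⊥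
  successor-isolated k h b with b (origin w Z (k , y))
      (origin-mono w Z P (prior-⊗⁺ P (ord P) Y (inj₂ (refl , prior-ord⁺ P ≤-refl)))) (origin-marked w Z (k , y) h)
  ... | u , p , q , mu with marked⇒origin w Z u mu
  ...   | t , refl , _ = no-gap P Y (origin-reflects w Z P p) (origin-reflects w Z P q)

  first-in-copy : ∀ k →
    (∀ u → prior P (w ⊙ Z) u (origin w Z (k , y)) → Marked w ⟦ w ⊙ Z ⟧ₜ u →
      Σ (Point (w ⊙ Z)) λ v → prior P (w ⊙ Z) u v × prior P (w ⊙ Z) v (origin w Z (k , y)) × Marked w ⟦ w ⊙ Z ⟧ₜ v) →
    prior P Z (l , x) (k , y) →
    Σ (Point Y) λ y' → origin w Z (k , y) ≡ origin w Z (0 , y') × HasPrior (P ∷ w) Y y'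
  first-in-copy zero b p with prior-⊗⁻ P (ord P) Y p
  ... | inj₁ q       = y , refl , x , q
  ... | inj₂ (_ , q) = ⊥-elim (n≮0 (prior-ord⁻ P q))
  first-in-copy (suc k) b p with prior-⊗⁻ P (ord P) Y p
  ... | inj₁ q = ⊥-elim (successor-isolated k
        (hasPrior-⊗ w P Y ((0 , x) , prior-⊗⁺ P (ord P) Y (inj₁ q))) b)
  ... | inj₂ (refl , q) with m<1+n⇒m<n∨m≡n (prior-ord⁻ P q)
  ...   | inj₂ refl = ⊥-elim (successor-isolated k hv b)
  ...   | inj₁ r    = ⊥-elim (successor-isolated k
            (hasPrior-⊗ w P Y ((l , x) , prior-⊗⁺ P (ord P) Y (inj₂ (refl , prior-ord⁺ P r)))) b)

-- Player I picks a marked point over `Y'`; there is none over `Y`. One move is spent besides those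
-- needed to check marking.
first-distinguished : ∀ {p} P (w : Vec Dir p) Y Y' →
  (∀ x y → ¬ prior P Y x y) → (Σ (Point Y') λ y → HasPrior (P ∷ w) Y' y) →
  ¬ (⟦ (P ∷ w) ⊙ Y ⟧ₜ ≡[ suc (twice (suc p)) ] ⟦ (P ∷ w) ⊙ Y' ⟧ₜ)
first-distinguished {p} P w Y Y' none (y , h) (_ , g) =
  let z = origin (P ∷ w) Y' y
      x , win = g z
      X  = (P ∷ w) ⊙ Y
      X' = (P ∷ w) ⊙ Y'
      y₀ , _ , y₁ , q = marked⇒origin (P ∷ w) Y x
        (marked-transfer (P ∷ w) (twice (suc p)) ⟦ X' ⟧ₜ ⟦ X ⟧ₜ (z ∷ []) (x ∷ []) ≤-refl
          (win-sym (twice (suc p)) {⟦ X ⟧ₜ} {⟦ X' ⟧ₜ} win) zero (origin-marked (P ∷ w) Y' y h))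
  in none y₁ y₀ q

-- Player I picks the origin over the last element of `Y`, then a marked point beyond the answer; no
-- marked point lies beyond the first choice. Two moves are spent besides marking.
last-distinguished : ∀ {p} P (w : Vec Dir p) Y Y' →
  (Σ (Point Y) λ x → ∀ y → ¬ prior P Y x y) → (∀ x → Σ (Point Y') λ y → prior P Y' x y) →
  ¬ (⟦ (P ∷ w) ⊙ Y ⟧ₜ ≡[ suc (suc (twice (suc p))) ] ⟦ (P ∷ w) ⊙ Y' ⟧ₜ)
last-distinguished {p} P w Y Y' (x , end) next (f , _) = contra (proj₁ (f z)) (proj₂ (f z))
  where
  X  = (P ∷ w) ⊙ Y
  X' = (P ∷ w) ⊙ Y'
  z  = origin (P ∷ w) Y x

  contra : ∀ z' → Win ⟦ X ⟧ₜ ⟦ X' ⟧ₜ (suc (twice (suc p))) (z ∷ []) (z' ∷ []) → ⊥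
  -- The answer `z'` may be any point, so only its copy is used. That copy is prior to `y'`, which
  -- makes the origin of `y'` both marked and beyond `z'`.
  contra z' (_ , g) with next (copy (P ∷ w) Y' z')
  ... | y' , q with g (origin (P ∷ w) Y' y')
  ...   | u , win with marked⇒origin (P ∷ w) Y u
            (marked-transfer (P ∷ w) (twice (suc p)) ⟦ X' ⟧ₜ ⟦ X ⟧ₜ
              (origin (P ∷ w) Y' y' ∷ z' ∷ []) (u ∷ z ∷ []) ≤-refl
              (win-sym (twice (suc p)) {⟦ X ⟧ₜ} {⟦ X' ⟧ₜ} win) zero (origin-marked (P ∷ w) Y' y' (_ , q)))
  ...     | y , refl , _ = end y (origin-reflects (P ∷ w) Y P
              (win-prior P (twice (suc p)) ⟦ X' ⟧ₜ ⟦ X ⟧ₜ (origin (P ∷ w) Y' y' ∷ z' ∷ []) (u ∷ z ∷ [])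
                (win-sym (twice (suc p)) {⟦ X ⟧ₜ} {⟦ X' ⟧ₜ} win) (suc zero) zero
                (prior-origin (P ∷ w) Y' P q)))

Discrete : Dir → Term → Set
Discrete P Y = ∀ y → Σ (Point Y) λ x → prior P Y x y × (∀ v → prior P Y x v → prior P Y v y → ⊥)

HasLimit : Dir → Term → Set
HasLimit P Y = Σ (Point Y) λ y → (Σ (Point Y) λ x → prior P Y x y) ×
  (∀ u → prior P Y u y → Σ (Point Y) λ v → prior P Y u v × prior P Y v y)

-- Limits of marked points are the points marked for the word with `P` repeated, at the price of two
-- more quantifiers. In the discrete case every origin is marked and has an immediate marked
-- neighbour, so no limit exists.
limit-distinguished : ∀ {p} P (w : Vec Dir p) Y Y' → Discrete P Y → HasLimit P Y' →
  ¬ (⟦ (P ∷ w) ⊙ Y ⟧ₜ ≡[ suc (twice (suc (suc p))) ] ⟦ (P ∷ w) ⊙ Y' ⟧ₜ)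
limit-distinguished {p} P w Y Y' discrete (y , (x , x<y) , dense) (_ , g) =
  contra (proj₁ (g z))
    (marked-transfer (P ∷ P ∷ w) (twice (suc (suc p))) ⟦ X' ⟧ₜ ⟦ X ⟧ₜ (z ∷ []) (proj₁ (g z) ∷ []) ≤-refl
      (win-sym (twice (suc (suc p))) {⟦ X ⟧ₜ} {⟦ X' ⟧ₜ} (proj₂ (g z))) zero z-marked)
  where
  X  = (P ∷ w) ⊙ Y
  X' = (P ∷ w) ⊙ Y'
  z  = origin (P ∷ w) Y' y

  between : ∀ u → prior P X' u z → Marked (P ∷ w) ⟦ X' ⟧ₜ u →
    Σ (Point X') λ v → prior P X' u v × prior P X' v z × Marked (P ∷ w) ⟦ X' ⟧ₜ v
  between u u<z mu with marked⇒origin (P ∷ w) Y' u mu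
  ... | t , refl , _ with dense t (origin-reflects (P ∷ w) Y' P u<z)
  ...   | v , t<v , v<y = origin (P ∷ w) Y' v , origin-mono (P ∷ w) Y' P t<v
                        , origin-mono (P ∷ w) Y' P v<y , origin-marked (P ∷ w) Y' v (t , t<v)

  z-marked : Marked (P ∷ P ∷ w) ⟦ X' ⟧ₜ z
  -- The origin of `x` may be unmarked; that of `v` is marked since `x` is prior to `v`.
  z-marked with dense x x<y
  ... | v , x<v , v<y = origin-marked (P ∷ w) Y' y (x , x<y)
    , (origin (P ∷ w) Y' v , origin-mono (P ∷ w) Y' P v<y , origin-marked (P ∷ w) Y' v (x , x<v))
    , between

  contra : ∀ z' → Marked (P ∷ P ∷ w) ⟦ X ⟧ₜ z' → ⊥
  contra z' (mz , _ , between') with marked⇒origin (P ∷ w) Y z' mz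
  ... | t , refl , _ with discrete t
  ...   | s , s<t , gap with between' (origin (P ∷ w) Y s) (origin-mono (P ∷ w) Y P s<t)
            (origin-marked (P ∷ w) Y s (_ , proj₁ (proj₂ (discrete s))))
  ...     | v , s<v , v<t , mv with marked⇒origin (P ∷ w) Y v mv
  ...       | r , refl , _ = gap r (origin-reflects (P ∷ w) Y P s<v) (origin-reflects (P ∷ w) Y P v<t)

-- Normal forms of the two products

pow : Dir → ℕ → Term
pow P zero    = 𝟏
pow P (suc k) = pow P k ⊗ ord P

prod : (s : ℕ) → (Fin s → Dir) → (Fin s → ℕ) → Term
prod zero    M m = 𝟏
prod (suc s) M m = pow (M zero) (m zero) ⊗ prod s (M ∘ suc) (m ∘ suc)

ord-order : ∀ P → ⟦ ord P ⟧ₜ ≡ ⟦ P ⟧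
ord-order omega  = refl
ord-order omega* = refl

pow-order : ∀ P k → ⟦ pow P k ⟧ₜ ≡ ⟦ P ⟧ ^ k
pow-order P zero    = refl
pow-order P (suc k) = cong₂ _·_ (pow-order P k) (ord-order P)

prod-order : ∀ s M m → ⟦ prod s M m ⟧ₜ ≡ ∏ s (λ i → ⟦ M i ⟧ ^ m i)
prod-order zero    M m = refl
prod-order (suc s) M m = cong₂ _·_ (pow-order (M zero) (m zero)) (prod-order s (M ∘ suc) (m ∘ suc))

pow-point : ∀ P k → Point (pow P k)
pow-point P zero    = tt
pow-point P (suc k) = pow-point P k , 0

prod-point : ∀ s M m → Point (prod s M m)
prod-point zero    M m = tt
prod-point (suc s) M m = pow-point (M zero) (m zero) , prod-point s (M ∘ suc) (m ∘ suc)

pow-+ : ∀ P j k → pow P (k + j) ≃ pow P j ⊗ pow P k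
pow-+ P j zero    n = ≃-sym (⊗-identityʳ n)
pow-+ P j (suc k) n = ≃-trans (⊗-cong (pow-+ P j k n) ≃-refl) (⊗-assoc n)

repeat : ∀ {p} (k : ℕ) → Dir → Vec Dir p → Vec Dir (k + p)
repeat zero    P w = w
repeat (suc k) P w = P ∷ repeat k P w

word-repeat : ∀ {p} k P (w : Vec Dir p) → word w ⊗ pow P k ≃ word (repeat k P w)
word-repeat zero    P w n = ⊗-identityʳ n
word-repeat (suc k) P w n = ≃-trans (≃-sym (⊗-assoc n)) (⊗-cong (word-repeat k P w n) ≃-refl)

first-toward-pow : ∀ P k → First (toward P (pow P k))
first-toward-pow omega  zero    = tt
first-toward-pow omega  (suc k) = first-toward-pow omega k , tt
first-toward-pow omega* zero    = tt
first-toward-pow omega* (suc k) = first-toward-pow omega* k , tt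

first-toward-⊗ : ∀ P a b → First (toward P a) → First (toward P b) → First (toward P (a ⊗ b))
first-toward-⊗ omega  a b f g = f , g
first-toward-⊗ omega* a b f g = f , g

noFirst-toward-pow : ∀ P k → NoFirst (toward P (pow (opp P) (suc k)))
noFirst-toward-pow omega  k = inj₂ tt
noFirst-toward-pow omega* k = inj₂ tt

noFirst-toward-⊗ : ∀ P a b → NoFirst (toward P a) ⊎ NoFirst (toward P b) → NoFirst (toward P (a ⊗ b))
noFirst-toward-⊗ omega  a b f = f
noFirst-toward-⊗ omega* a b f = f

toward-point : ∀ P Y → Point Y → Point (toward P Y)
toward-point omega  Y y = y
toward-point omega* Y y = mirror Y y

toward-rev : ∀ P Y → NoFirst (toward (opp P) Y) → NoFirst (rev (toward P Y))
toward-rev omega  Y f = f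
toward-rev omega* Y f = subst NoFirst (sym (rev-involutive Y)) f

module _ {p} (P : Dir) (w : Vec Dir p) (Y Y' : Term) where

  ≃-firsts : First (toward P Y) → First (toward P Y') →
    word (P ∷ w) ⊗ Y ≃[ twice (suc p) ] word (P ∷ w) ⊗ Y'
  ≃-firsts f f' = dualize P w Y Y' λ v → firsts v _ ≤-refl _ _ f f'

  ≃-noFirsts : NoFirst (toward P Y) → NoFirst (toward P Y') → Point Y → Point Y' →
    word (P ∷ w) ⊗ Y ≃[ suc (twice (suc p)) ] word (P ∷ w) ⊗ Y'
  ≃-noFirsts f f' y y' = dualize P w Y Y' λ v →
    noFirsts v _ ≤-refl _ _ f f' (toward-point P Y y) (toward-point P Y' y')

  ≃-noEnds : NoFirst (toward P Y) → NoFirst (toward P Y') →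
    NoFirst (toward (opp P) Y) → NoFirst (toward (opp P) Y') → Point Y → Point Y' →
    word (P ∷ w) ⊗ Y ≃[ suc (suc (twice (suc p))) ] word (P ∷ w) ⊗ Y'
  ≃-noEnds f f' l l' y y' = dualize P w Y Y' λ v →
    noEnds v _ _ f f' (toward-rev P Y l) (toward-rev P Y' l') (toward-point P Y y) (toward-point P Y' y')

-- The immediate neighbour is found inside the same copy of `a`, where points of other copies cannot
-- intervene.
discrete-⊗ : ∀ P a b → Discrete P a → Discrete P (a ⊗ b)
discrete-⊗ P a b d (x , y) with d x
... | x' , p , gap = (x' , y) , prior-⊗⁺ P a b (inj₂ (refl , p)) , λ (v , z) q r →
  case (prior-⊗⁻ P a b q) (prior-⊗⁻ P a b r)
  where
  case : ∀ {v z} → prior P b y z ⊎ (y ≡ z × prior P a x' v) → prior P b z y ⊎ (z ≡ y × prior P a v x) → ⊥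
  case (inj₁ q)          (inj₁ r)          = prior-irrefl P b (prior-trans P b q r)
  case (inj₁ q)          (inj₂ (refl , _)) = prior-irrefl P b q
  case (inj₂ (refl , _)) (inj₁ r)          = prior-irrefl P b r
  case (inj₂ (refl , q)) (inj₂ (_ , r))    = gap _ q r

discrete-pow : ∀ P k → Discrete P (pow (opp P) (suc k))
discrete-pow P (suc k) = discrete-⊗ P (pow (opp P) (suc k)) (ord (opp P)) (discrete-pow P k)
discrete-pow P zero (tt , k) =
  (tt , suc k) , prior-⊗⁺ P 𝟏 (ord (opp P)) (inj₁ (prior-opp⁺ P ≤-refl)) , gap
  where
  unit-least : ∀ P {x y} → ¬ prior P 𝟏 x y
  unit-least omega  ()
  unit-least omega* ()

  gap : ∀ v → prior P (pow (opp P) 1) (tt , suc k) v → prior P (pow (opp P) 1) v (tt , k) → ⊥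
  gap v q r with prior-⊗⁻ P 𝟏 (ord (opp P)) q | prior-⊗⁻ P 𝟏 (ord (opp P)) r
  ... | inj₁ s       | inj₁ t       = <-irrefl refl (<-≤-trans (prior-opp⁻ P t) (s≤s⁻¹ (prior-opp⁻ P s)))
  ... | inj₂ (_ , s) | _            = unit-least P s
  ... | _            | inj₂ (_ , t) = unit-least P t

pow-next : ∀ P k x → Σ (Point (pow P (suc k))) λ y → prior P (pow P (suc k)) x y
pow-next P k (x , i) = (x , suc i) , prior-⊗⁺ P (pow P k) (ord P) (inj₁ (prior-ord⁺ P ≤-refl))

pow-start : ∀ P k x → ¬ prior P (pow P k) x (pow-point P k)
pow-start omega  zero    x ()
pow-start omega* zero    x ()
pow-start P      (suc k) (x , i) p with prior-⊗⁻ P (pow P k) (ord P) p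
... | inj₁ q       = n≮0 (prior-ord⁻ P q)
... | inj₂ (_ , q) = pow-start P k x q

pow-end : ∀ P k x → ¬ prior P (pow (opp P) k) (pow-point (opp P) k) x
pow-end omega  zero    x ()
pow-end omega* zero    x ()
pow-end P      (suc k) (x , i) p with prior-⊗⁻ P (pow (opp P) k) (ord (opp P)) p
... | inj₁ q       = n≮0 (prior-opp⁻ P q)
... | inj₂ (_ , q) = pow-end P k x q

-- Seen from the side of `P`, the power has a first point and no last one. The first point of a copy
-- that has a prior copy is thus a limit: every earlier copy contains points beyond any given one.
hasLimit-pow : ∀ P k a b → Point b → (∀ x → Σ (Point a) λ y → prior P a y x) → Point a →
  HasLimit P (pow P (suc k) ⊗ (a ⊗ b))
hasLimit-pow P k a b y prev x =
  (o , (x , y)) , ((o , (proj₁ (prev x) , y)) ,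
      prior-⊗⁺ P Q (a ⊗ b) (inj₁ (prior-⊗⁺ P a b (inj₂ (refl , proj₂ (prev x)))))) ,
  λ (u , r) p → dense u r (prior-⊗⁻ P Q (a ⊗ b) p)
  where
  Q = pow P (suc k)
  o = pow-point P (suc k)
  dense : ∀ u r → prior P (a ⊗ b) r (x , y) ⊎ (r ≡ (x , y) × prior P Q u o) →
    Σ (Point (Q ⊗ (a ⊗ b))) λ v → prior P (Q ⊗ (a ⊗ b)) (u , r) v × prior P (Q ⊗ (a ⊗ b)) v (o , (x , y))
  dense u r (inj₁ p) with pow-next P k u
  ... | v , q = (v , r) , prior-⊗⁺ P Q (a ⊗ b) (inj₂ (refl , q)) , prior-⊗⁺ P Q (a ⊗ b) (inj₁ p)
  dense u r (inj₂ (_ , p)) = ⊥-elim (pow-start P (suc k) u p)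

-- The length in the three cases

record Length (X Y : Term) (n : ℕ) : Set where
  constructor hasLength
  field length : lEq ⟦ X ⟧ₜ ⟦ Y ⟧ₜ n
open Length

length-resp-≃ : ∀ {n X X' Y Y'} → X ≃ X' → Y ≃ Y' → Length X' Y' n → Length X Y n
length-resp-≃ {n} {X} {X'} {Y} {Y'} p q (hasLength (b , win , no-win)) = hasLength
  ( b
  , win-trans n {⟦ X ⟧ₜ} {⟦ X' ⟧ₜ} {⟦ Y ⟧ₜ} (≃⇒≡ (p n))
      (win-trans n {⟦ X' ⟧ₜ} {⟦ Y' ⟧ₜ} {⟦ Y ⟧ₜ} win (≃⇒≡ (≃-sym (q n))))
  , λ win' → no-win
      (win-trans (suc n) {⟦ X' ⟧ₜ} {⟦ X ⟧ₜ} {⟦ Y' ⟧ₜ} (≃⇒≡ (≃-sym (p (suc n))))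
        (win-trans (suc n) {⟦ X ⟧ₜ} {⟦ Y ⟧ₜ} {⟦ Y' ⟧ₜ} win' (≃⇒≡ (q (suc n))))))

-- Joins the two bracketings: upper bounds are proved for `word w ⊗ Y`, lower bounds for `w ⊙ Y`.
word-length : ∀ {n p} (w : Vec Dir p) Y Y' → 1 ≤ n → word w ⊗ Y ≃[ n ] word w ⊗ Y' →
  ¬ (⟦ w ⊙ Y ⟧ₜ ≡[ suc n ] ⟦ w ⊙ Y' ⟧ₜ) → Length (word w ⊗ Y) (word w ⊗ Y') n
word-length {n} w Y Y' b p no-win = length-resp-≃ (word-⊙ w Y) (word-⊙ w Y') (hasLength
  ( b
  , ≃⇒≡ (≃-trans (≃-sym (word-⊙ w Y n)) (≃-trans p (word-⊙ w Y' n)))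
  , no-win))

module _ {p} (P : Dir) (w : Vec Dir p) (d : ℕ) where

  private
    -- The surplus of the larger exponent over the smaller is `suc d`, at least one.
    Q = pow P (suc d)
    W = word (P ∷ w)

  length-at-end : Length (W ⊗ 𝟏) (W ⊗ (Q ⊗ 𝟏)) (twice (suc p))
  length-at-end = word-length (P ∷ w) _ _ (s≤s z≤n)
    (≃-firsts P w _ _ (first-toward-pow P 0) (first-toward-⊗ P Q 𝟏 (first-toward-pow P (suc d)) (first-toward-pow P 0)))
    (first-distinguished P w _ _ (λ x _ → pow-start P 0 x)
      ((proj₁ next , tt) , (pow-point P (suc d) , tt) , prior-⊗⁺ P Q 𝟏 (inj₂ (refl , proj₂ next))))
    where next = pow-next P d (pow-point P (suc d))

  -- From the side of `P`, a power of `opp P` has no first element but a last one; the innermost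
  -- factor `Q` takes the last one away.
  length-one-before : ∀ a b → Length (W ⊗ (pow (opp P) (suc a) ⊗ 𝟏)) (W ⊗ (Q ⊗ (pow (opp P) (suc b) ⊗ 𝟏)))
    (suc (twice (suc p)))
  length-one-before a b = word-length (P ∷ w) _ _ (s≤s z≤n)
    (≃-noFirsts P w _ _
      (noFirst-toward-⊗ P _ 𝟏 (inj₁ (noFirst-toward-pow P a)))
      (noFirst-toward-⊗ P Q _ (inj₂ (noFirst-toward-⊗ P _ 𝟏 (inj₁ (noFirst-toward-pow P b)))))
      (pow-point (opp P) (suc a) , tt) (pow-point P (suc d) , pow-point (opp P) (suc b) , tt))
    (last-distinguished P w _ _
      ((pow-point (opp P) (suc a) , tt) , λ (y , _) q → end y (prior-⊗⁻ P (pow (opp P) (suc a)) 𝟏 q))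
      (λ (x , r) → (proj₁ (pow-next P d x) , r) ,
        prior-⊗⁺ P Q (pow (opp P) (suc b) ⊗ 𝟏) (inj₂ (refl , proj₂ (pow-next P d x)))))
    where
    end : ∀ y → prior P 𝟏 tt tt ⊎ (tt ≡ tt × prior P (pow (opp P) (suc a)) (pow-point (opp P) (suc a)) y) → ⊥
    end y (inj₁ q)       = pow-start P 0 tt q
    end y (inj₂ (_ , q)) = pow-end P (suc a) y q

  -- Two further alternating factors remove both ends. What still differs is the innermost factor: a
  -- power of `opp P` makes the order discrete, `Q` creates limits.
  length-before : ∀ a b a' b' R R' → Point R → Point R' →
    Length (W ⊗ (pow (opp P) (suc a) ⊗ (pow (opp (opp P)) (suc a') ⊗ R)))
           (W ⊗ (Q ⊗ (pow (opp P) (suc b) ⊗ (pow (opp (opp P)) (suc b') ⊗ R'))))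
           (suc (suc (twice (suc p))))
  length-before a b a' b' R R' r r' = word-length (P ∷ w) _ _ (s≤s z≤n)
    (≃-noEnds P w _ _
      (startless a (pow (opp (opp P)) (suc a') ⊗ R)) (noFirst-toward-⊗ P Q _ (inj₂ (startless b _)))
      (endless a a' R) (noFirst-toward-⊗ (opp P) Q _ (inj₂ (endless b b' R')))
      (inhabited a a' R r) (pow-point P (suc d) , inhabited b b' R' r'))
    (limit-distinguished P w _ _
      (discrete-⊗ P (pow (opp P) (suc a)) (pow (opp (opp P)) (suc a') ⊗ R) (discrete-pow P a))
      (hasLimit-pow P d (pow (opp P) (suc b)) (pow (opp (opp P)) (suc b') ⊗ R') (pow-point (opp (opp P)) (suc b') , r')
        (λ x → let y , q , _ = discrete-pow P b x in y , q) (pow-point (opp P) (suc b))))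
    where
    startless : ∀ k Z → NoFirst (toward P (pow (opp P) (suc k) ⊗ Z))
    startless k Z = noFirst-toward-⊗ P _ Z (inj₁ (noFirst-toward-pow P k))

    endless : ∀ k l Z → NoFirst (toward (opp P) (pow (opp P) (suc k) ⊗ (pow (opp (opp P)) (suc l) ⊗ Z)))
    endless k l Z = noFirst-toward-⊗ (opp P) (pow (opp P) (suc k)) _ (inj₂
      (noFirst-toward-⊗ (opp P) _ Z (inj₁ (noFirst-toward-pow (opp P) l))))

    inhabited : ∀ k l Z → Point Z → Point (pow (opp P) (suc k) ⊗ (pow (opp (opp P)) (suc l) ⊗ Z))
    inhabited k l Z z = pow-point (opp P) (suc k) , pow-point (opp (opp P)) (suc l) , z

-- Reduction to the first differing exponent

twice≡2* : ∀ n → twice n ≡ 2 * n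
twice≡2* zero    = refl
twice≡2* (suc n) = cong suc (trans (cong suc (twice≡2* n)) (sym (+-suc n (n + 0))))

psum-zero : ∀ s (m : Fin s → ℕ) → psum m 0 ≡ 0
psum-zero zero    m = refl
psum-zero (suc s) m = refl

≢⇒opp : ∀ {P Q} → P ≢ Q → P ≡ opp Q
≢⇒opp {omega}  {omega}  h = ⊥-elim (h refl)
≢⇒opp {omega}  {omega*} h = refl
≢⇒opp {omega*} {omega}  h = refl
≢⇒opp {omega*} {omega*} h = ⊥-elim (h refl)

Conclusion : (s t S : ℕ) → Term → Term → Set
Conclusion s t S X Y = (suc t ≡ s → Length X Y (twice S))
                     × (suc (suc t) ≡ s → Length X Y (suc (twice S)))
                     × (suc (suc t) < s → Length X Y (suc (suc (twice S))))

conclusion-resp-≃ : ∀ {s t S X X' Y Y'} → X ≃ X' → Y ≃ Y' → Conclusion s t S X' Y' → Conclusion s t S X Y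
conclusion-resp-≃ p q (f , g , h) =
  length-resp-≃ p q ∘ f , length-resp-≃ p q ∘ g , length-resp-≃ p q ∘ h

Alternating : ∀ {s} → (Fin s → Dir) → Set
Alternating M = ∀ i j → toℕ j ≡ suc (toℕ i) → M j ≢ M i

-- The common power of the first factor is already inside the word; `m` and `n` list only the later
-- exponents. Alternation turns the next two directions into `opp` and `opp` of `opp`.
first-difference : ∀ {p} (w : Vec Dir p) d s (M : Fin (suc s) → Dir) → Alternating M →
  (m n : Fin s → ℕ) → (∀ i → NonZero (m i)) → (∀ i → NonZero (n i)) →
  Conclusion (suc s) 0 (suc p) (word (M zero ∷ w) ⊗ prod s (M ∘ suc) m)
                               (word (M zero ∷ w) ⊗ (pow (M zero) (suc d) ⊗ prod s (M ∘ suc) n))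
first-difference w d zero M alt m n m≢0 n≢0 =
  (λ _ → length-at-end (M zero) w d) , (λ ()) , λ { (s≤s ()) }
first-difference w d (suc zero) M alt m n m≢0 n≢0
  with M (suc zero) | ≢⇒opp (alt zero (suc zero) refl) | m zero | n zero | m≢0 zero | n≢0 zero
... | _ | refl | suc a | suc b | _ | _ =
  (λ ()) , (λ _ → length-one-before (M zero) w d a b) , λ { (s≤s (s≤s ())) }
first-difference w d (suc (suc s)) M alt m n m≢0 n≢0
  with M (suc zero) | ≢⇒opp (alt zero (suc zero) refl)
     | M (suc (suc zero)) | ≢⇒opp (alt (suc zero) (suc (suc zero)) refl)
     | m zero | n zero | m≢0 zero | n≢0 zero
     | m (suc zero) | n (suc zero) | m≢0 (suc zero) | n≢0 (suc zero)
... | _ | refl | _ | refl | suc a | suc b | _ | _ | suc a' | suc b' | _ | _ =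
  (λ ()) , (λ ()) , λ _ → length-before (M zero) w d a b a' b' _ _ (prod-point s _ _) (prod-point s _ _)

extend-≃ : ∀ {p} (w : Vec Dir p) k P Z → word w ⊗ (pow P k ⊗ Z) ≃ word (repeat k P w) ⊗ Z
extend-≃ w k P Z n = ≃-trans (≃-sym (⊗-assoc n)) (⊗-cong (word-repeat k P w n) ≃-refl)

-- Induction on `t`, moving equal leading powers into the prefix `w`. Its length `p` accounts for
-- the exponents already removed from the sum.
conclusion-prefixed : ∀ {p} (w : Vec Dir p) s (M : Fin s → Dir) → Alternating M →
  (m n : Fin s → ℕ) → (∀ i → NonZero (m i)) → (∀ i → NonZero (n i)) →
  (t : Fin s) → (∀ j → toℕ j < toℕ t → m j ≡ n j) → m t < n t →
  Conclusion s (toℕ t) (p + psum m (suc (toℕ t))) (word w ⊗ prod s M m) (word w ⊗ prod s M n)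
conclusion-prefixed {p} w (suc s) M alt m n m≢0 n≢0 zero agree m<n
  rewrite psum-zero s (m ∘ suc) | +-identityʳ (m zero)
  with m zero | m≢0 zero
... | suc k | _ = subst
  (λ S → Conclusion (suc s) 0 S (word w ⊗ (pow (M zero) (suc k) ⊗ prod s (M ∘ suc) (m ∘ suc)))
                                (word w ⊗ prod (suc s) M n))
  (+-comm (suc k) p)
  (conclusion-resp-≃
    (extend-≃ w (suc k) (M zero) _)
    (λ l → ≃-trans (⊗-cong ≃-refl (≃-trans
      (⊗-cong (≃-trans (≃-reflexive (cong (pow (M zero)) split)) (pow-+ (M zero) (suc k) (suc d) l)) ≃-refl)
      (⊗-assoc l))) (extend-≃ w (suc k) (M zero) _ l))
    (first-difference (repeat k (M zero) w) d s M alt (m ∘ suc) (n ∘ suc) (m≢0 ∘ suc) (n≢0 ∘ suc)))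
  where
  -- One less than the surplus, as `m zero` is `suc k` here and `Q` has exponent `suc d`.
  d = n zero ∸ suc (suc k)
  split : n zero ≡ suc d + suc k
  split = sym (trans (sym (+-suc d (suc k))) (m∸n+n≡m m<n))
conclusion-prefixed {p} w (suc s) M alt m n m≢0 n≢0 (suc t) agree m<n = step
  (conclusion-prefixed (repeat (m zero) (M zero) w) s (M ∘ suc) (λ i j e → alt (suc i) (suc j) (cong suc e))
    (m ∘ suc) (n ∘ suc) (m≢0 ∘ suc) (n≢0 ∘ suc) t (λ j l → agree (suc j) (s≤s l)) m<n)
  where
  S' = psum (m ∘ suc) (suc (toℕ t))

  level : (m zero + p) + S' ≡ p + (m zero + S')
  level = trans (cong (_+ S') (+-comm (m zero) p)) (+-assoc p (m zero) S')

  step : Conclusion s (toℕ t) ((m zero + p) + S')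
           (word (repeat (m zero) (M zero) w) ⊗ prod s (M ∘ suc) (m ∘ suc))
           (word (repeat (m zero) (M zero) w) ⊗ prod s (M ∘ suc) (n ∘ suc)) →
         Conclusion (suc s) (suc (toℕ t)) (p + (m zero + S'))
           (word w ⊗ prod (suc s) M m) (word w ⊗ prod (suc s) M n)
  step c rewrite sym level =
    let f , g , h = conclusion-resp-≃ {s} {toℕ t}
          (extend-≃ w (m zero) (M zero) _)
          (λ l → ≃-trans (⊗-cong ≃-refl (⊗-cong (≃-reflexive (cong (pow (M zero)) (sym (agree zero (s≤s z≤n))))) ≃-refl))
                         (extend-≃ w (m zero) (M zero) _ l)) c
    in f ∘ suc-injective , g ∘ suc-injective , λ { (s≤s q) → h q }

theorem3p4 : (s : ℕ) → 1 ≤ s → (M : Fin s → Dir)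
    → (∀ (i j : Fin s) → toℕ j ≡ suc (toℕ i) → M j ≢ M i)
    → (m n : Fin s → ℕ) → (∀ i → NonZero (m i)) → (∀ i → NonZero (n i))
    → (t : Fin s) → (∀ (j : Fin s) → toℕ j < toℕ t → m j ≡ n j) → m t < n t
    → let A = ∏ s (λ i → ⟦ M i ⟧ ^ m i)
          B = ∏ s (λ i → ⟦ M i ⟧ ^ n i)
          S = psum m (suc (toℕ t))
      in (suc (toℕ t) ≡ s → lEq A B (2 * S))
       × (suc (suc (toℕ t)) ≡ s → lEq A B (2 * S + 1))
       × (suc (suc (toℕ t)) < s → lEq A B (2 * S + 2))
theorem3p4 s 1≤s M alt m n m≢0 n≢0 t agree m<n
  rewrite sym (prod-order s M m) | sym (prod-order s M n)
        | +-comm (2 * psum m (suc (toℕ t))) 1 | +-comm (2 * psum m (suc (toℕ t))) 2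
        | sym (twice≡2* (psum m (suc (toℕ t))))
  -- The induction starts with the empty prefix, whose order `𝟏` is a left unit.
  = let f , g , h = conclusion-resp-≃ {s} {toℕ t} (λ k → ≃-sym (⊗-identityˡ k)) (λ k → ≃-sym (⊗-identityˡ k))
          (conclusion-prefixed [] s M alt m n m≢0 n≢0 t agree m<n)
    in length ∘ f , length ∘ g , length ∘ h
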